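{- Let $k\geq 3$ and let $F$ be a $k$-uniform hypergraph. If $|V(F)|\geq k+1$ and $F$ is not isomorphic to $D_2$, then there is a constant $C>0$ such that for every sufficiently large $n$ there exists an induced $F$-free $k$-uniform hypergraph $H$ on $n$ vertices such that every homogeneous set of $H$ has size at most $(\log n)^{C}$.
   Context: Hypergraphs are finite. $D_2$ denotes the $3$-uniform hypergraph with $4$ vertices and $2$ edges. A $k$-uniform hypergraph $H$ is induced $F$-free if no vertex subset $U\subseteq V(H)$ induces a sub-hypergraph $H[U]$ (whose edges are all the edges of $H$ contained in $U$) isomorphic to $F$. A homogeneous set of a $k$-uniform hypergraph is a clique (a vertex set all of whose $k$-subsets are edges) or an independent set (a vertex set none of whose $k$-subsets is an edge). -}

module Defs where

open import Data.Bool using (Bool; T; _∧_; _xor_)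
open import Data.Fin using (Fin)
open import Data.Fin.Subset using (Subset; inside; outside; ∣_∣; _⊆_)
open import Data.Integer using () renaming (∣_∣ to abs)
open import Data.Nat using (ℕ; suc; _*_; _^_; _≤_; _<_)
open import Data.Rational using (ℚ; ↥_; ↧ₙ_)
open import Data.Sum using (_⊎_)
open import Data.Vec using ([]; _∷_; lookup; tabulate)
open import Function.Bundles using (_↔_; Inverse)
open import Relation.Binary.PropositionalEquality using (_≡_; refl; cong; sym; trans)
open import Relation.Nullary using (¬_)

-- Every finite hypergraph is, up to isomorphism, one with vertex set Fin n.
record Hypergraph (k n : ℕ) : Set where
  field
    edge    : Subset n → Bool
    uniform : ∀ e → T (edge e) → ∣ e ∣ ≡ k

open Hypergraph public

-- For a bijection, the image is the preimage under the inverse.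
image : ∀ {m n} → Fin m ↔ Fin n → Subset m → Subset n
image π e = tabulate λ y → lookup e (Inverse.from π y)

-- The uniformities may differ, so that a k-uniform hypergraph with k
-- arbitrary can be compared with D₂.
record _≅_ {k l m n} (F : Hypergraph k m) (G : Hypergraph l n) : Set where
  field
    bijection : Fin m ↔ Fin n
    edges     : ∀ e → edge F e ≡ edge G (image bijection e)

-- The vertices of U, listed increasingly, are identified with Fin ∣ U ∣;
-- under this identification, embed U is the bijection from subsets of
-- Fin ∣ U ∣ to subsets of Fin n contained in U.
embed : ∀ {n} (U : Subset n) → Subset ∣ U ∣ → Subset n
embed []            e       = []
embed (outside ∷ U) e       = outside ∷ embed U e
embed (inside  ∷ U) (b ∷ e) = b ∷ embed U e

∣embed∣ : ∀ {n} (U : Subset n) (e : Subset ∣ U ∣) → ∣ embed U e ∣ ≡ ∣ e ∣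
∣embed∣ []            []            = refl
∣embed∣ (outside ∷ U) e             = ∣embed∣ U e
∣embed∣ (inside  ∷ U) (outside ∷ e) = ∣embed∣ U e
∣embed∣ (inside  ∷ U) (inside  ∷ e) = cong suc (∣embed∣ U e)

_[_] : ∀ {k n} → Hypergraph k n → (U : Subset n) → Hypergraph k ∣ U ∣
edge    (H [ U ]) e = edge H (embed U e)
uniform (H [ U ]) e p = trans (sym (∣embed∣ U e)) (uniform H (embed U e) p)

InducedFree : ∀ {k m n} → Hypergraph k m → Hypergraph k n → Set
InducedFree F H = ∀ U → ¬ ((H [ U ]) ≅ F)

Clique : ∀ {k n} → Hypergraph k n → Subset n → Set
Clique {k} H S = ∀ e → e ⊆ S → ∣ e ∣ ≡ k → T (edge H e)

Independent : ∀ {k n} → Hypergraph k n → Subset n → Set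
Independent {k} H S = ∀ e → e ⊆ S → ∣ e ∣ ≡ k → ¬ T (edge H e)

Homogeneous : ∀ {k n} → Hypergraph k n → Subset n → Set
Homogeneous H S = Clique H S ⊎ Independent H S

-- The edges are {0,1,2} and {0,1,3}.  Two distinct 3-subsets of a 4-set
-- always share exactly two vertices, so there is only one such
-- hypergraph up to isomorphism.
D₂ : Hypergraph 3 4
edge D₂ (a ∷ b ∷ c ∷ d ∷ []) = a ∧ b ∧ (c xor d)
uniform D₂ (inside  ∷ inside  ∷ inside  ∷ outside ∷ []) _ = refl
uniform D₂ (inside  ∷ inside  ∷ outside ∷ inside  ∷ []) _ = refl
uniform D₂ (inside  ∷ inside  ∷ inside  ∷ inside  ∷ []) ()
uniform D₂ (inside  ∷ inside  ∷ outside ∷ outside ∷ []) ()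
uniform D₂ (inside  ∷ outside ∷ _       ∷ _       ∷ []) ()
uniform D₂ (outside ∷ _       ∷ _       ∷ _       ∷ []) ()

-- s ≤ (log₂ n) ^ C as an inequality of real numbers, for n ≥ 1 and C = p / q
-- positive.  Raising to the power q, it says s ^ q ≤ (log₂ n) ^ p, and log₂ n
-- is the infimum of the fractions a / b with log₂ n ≤ a / b, that is, with
-- n ^ b ≤ 2 ^ a.
_≤log₂_^_ : ℕ → ℕ → ℚ → Set
s ≤log₂ n ^ C = ∀ a b → 0 < b → n ^ b ≤ 2 ^ a → s ^ q * b ^ p ≤ a ^ p
  where
  p = abs (↥ C)
  q = ↧ₙ C

{-# OPTIONS --safe #-}
module Submission where

-- Let deg W be the number of edges spanned by a set W of k + 1 vertices of F.  It suffices to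
-- construct, for a single W, k-uniform hypergraphs with small homogeneous sets in which no
-- (k + 1)-set spans exactly deg W edges.
--
-- If k ≥ 4, let the vertices be the leaves of a binary tree of depth about log₂ n, and let the
-- membership of e in the edge set depend only on the numbers (a , b) of vertices of e on both
-- sides of the vertex of the tree at which e first branches.  A set of more than k log₂ n + O(1)
-- leaves has a branching with more than k leaves on either side, so it contains k-sets of all
-- types (a , b), hence is not homogeneous as soon as the rule is not constant.  Each value of
-- deg W is excluded by one of the rules "a, b ≥ 2", "a = 2" and "a ≠ 2".
--
-- If k = 3 and some four vertices of F do not span two edges, take a 2-colouring of the pairs
-- without monochromatic sets of size about 2 log₂ n, and let x < y < z be an edge if xy and yz are
-- red and xz is blue.  Four vertices span at most two edges, and on an independent set red is a
-- partial order, so that Mirsky's theorem bounds its size.  This hypergraph or its complement has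
-- no induced F.  Otherwise any four vertices of F span two edges, and F has at least five
-- vertices as it is not D₂; then the tree construction with the rule "a = 1" works, since five
-- leaves contain four leaves of type (1 , 3) or (3 , 1).

open import Defs
open import Data.Fin.Subset using (∣_∣)
open import Data.Nat using (ℕ; _+_; _≥_)
open import Data.Product using (∃-syntax; _×_)
open import Data.Rational using (0ℚ; _<_)
open import Relation.Nullary using (¬_)

open import Algebra.Properties.CommutativeMonoid.Sum using (sum-permute)
open import Algebra.Properties.Monoid.Sum using (sum-cong-≗)
open import Data.Bool using (Bool; true; false; T; _∧_; _xor_; not; if_then_else_)
open import Data.Bool.ListAction using (any)
open import Data.Bool.Properties using (T-≡; ∧-zeroʳ; ¬-not)
open import Data.Empty using (⊥-elim)
open import Data.Fin as Fin using (Fin; zero; suc; finToFun; funToFin; inject≤)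
open import Data.Fin.Patterns using (0F; 1F; 2F; 3F)
open import Data.Fin.Permutation using (flip; ↔⇒≡; transpose; _∘ₚ_) renaming (id to idₚ)
open import Data.Fin.Properties as Fin using (funToFin-finToFin; inject≤-injective)
open import Data.Fin.Subset using (Subset; inside; outside; ∁; _∩_; _∈_; _∉_; _⊆_; ⊤)
open import Data.Fin.Subset.Properties hiding (⊆-refl; ⊆-trans)
open import Data.Integer as ℤ using (+<+)
open import Data.List as List using (List; []; _∷_; length)
open import Data.List.Membership.Propositional using () renaming (_∈_ to _∈ˡ_)
open import Data.List.Membership.Propositional.Properties using (∈-map⁺; ∈-++⁺ˡ; ∈-++⁺ʳ)
open import Data.List.Properties using (length-map; length-++; length-take)
open import Data.List.Relation.Binary.Sublist.Propositional using ([]; _∷_; _∷ʳ_; minimum; ⊆-trans; from∈) renaming (_⊆_ to _⊆ˡ_)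
open import Data.List.Relation.Binary.Sublist.Propositional.Properties using (All-resp-⊆; take-⊆)
open import Data.List.Relation.Unary.All as All using (All; []; _∷_)
open import Data.List.Relation.Unary.All.Properties as All using ()
open import Data.List.Relation.Unary.AllPairs as AllPairs using (AllPairs; []; _∷_)
open import Data.List.Relation.Unary.AllPairs.Properties as AllPairs using ()
open import Data.List.Relation.Unary.Any using (here; there)
open import Data.Maybe using (Maybe; just; nothing)
open import Data.Nat as ℕ using (zero; suc; _*_; _^_; _≤_; z≤n; s≤s; _≡ᵇ_; _≤ᵇ_)
open import Data.Nat.Properties
open import Data.Nat.Tactic.RingSolver using (solve-∀)
open import Data.Product using (_,_; proj₁; proj₂; ∃; uncurry)
open import Data.Rational using (*<*; _/_)
open import Data.Sum using (_⊎_; inj₁; inj₂; [_,_]′)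
open import Data.Vec as Vec using (Vec; []; _∷_; lookup; tabulate; here; there; _[_]≔_; _++_; take; drop)
open import Data.Vec.Functional as Vector using (Vector)
open import Data.Vec.Properties using (lookup∘tabulate; lookup∘update; lookup∘update′; lookup⇒[]=; []=⇒lookup; take++drop≡id)
open import Data.Vec.Relation.Binary.Pointwise.Inductive as Pointwise using (Pointwise; []; _∷_)
open import Function using (_∘_; const; id)
open import Function.Bundles using (_↔_; Inverse; Equivalence)
open import Relation.Binary.PropositionalEquality using (_≡_; _≢_; refl; sym; trans; cong; cong₂; subst; subst₂; module ≡-Reasoning)
open import Relation.Nullary using (yes; no; Dec; _×-dec_; ¬?)
open import Relation.Nullary.Decidable using (map′; from-yes; decidable-stable)

-- Counting elements of finite sets

sum : ∀ {n} → Vector ℕ n → ℕ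
sum = Vector.foldr _+_ 0

sum-cong : ∀ {n} {f g : Vector ℕ n} → (∀ i → f i ≡ g i) → sum f ≡ sum g
sum-cong = sum-cong-≗ +-0-monoid

⟦_⟧ : Bool → ℕ
⟦ b ⟧ = if b then 1 else 0

_∖_ : ∀ {n} → Subset n → Fin n → Subset n
W ∖ x = W [ x ]≔ outside

cnt : ∀ {n} → (Fin n → Bool) → Subset n → ℕ
cnt Q S = sum λ x → ⟦ lookup S x ∧ Q x ⟧

-- For a set W of k + 1 vertices, the number of k-subsets of W satisfying P.
deg : ∀ {n} → (Subset n → Bool) → Subset n → ℕ
deg P W = cnt (λ x → P (W ∖ x)) W

cnt-cong : ∀ {n} {Q R : Fin n → Bool} (S : Subset n) → (∀ {x} → x ∈ S → Q x ≡ R x) → cnt Q S ≡ cnt R S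
cnt-cong []            eq = refl
cnt-cong (inside  ∷ S) eq = cong₂ (λ b → ⟦ b ⟧ +_) (eq here) (cnt-cong S (eq ∘ there))
cnt-cong (outside ∷ S) eq = cnt-cong S (eq ∘ there)

cnt-const : ∀ {n} (b : Bool) (S : Subset n) → cnt (const b) S ≡ ∣ S ∣ * ⟦ b ⟧
cnt-const b     []            = refl
cnt-const b     (inside  ∷ S) = cong (⟦ b ⟧ +_) (cnt-const b S)
cnt-const b     (outside ∷ S) = cnt-const b S

cnt-≤ : ∀ {n} (Q : Fin n → Bool) (S : Subset n) → cnt Q S ≤ ∣ S ∣
cnt-≤ Q []            = z≤n
cnt-≤ Q (outside ∷ S) = cnt-≤ (Q ∘ suc) S
cnt-≤ Q (inside  ∷ S) with Q zero
... | true  = s≤s (cnt-≤ (Q ∘ suc) S)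
... | false = m≤n⇒m≤1+n (cnt-≤ (Q ∘ suc) S)

cnt-not : ∀ {n} (Q : Fin n → Bool) (S : Subset n) → cnt Q S + cnt (not ∘ Q) S ≡ ∣ S ∣
cnt-not Q []            = refl
cnt-not Q (outside ∷ S) = cnt-not (Q ∘ suc) S
cnt-not Q (inside  ∷ S) with Q zero
... | true  = cong suc (cnt-not (Q ∘ suc) S)
... | false = trans (+-suc _ _) (cong suc (cnt-not (Q ∘ suc) S))

cnt-split : ∀ {n} (Q : Fin n → Bool) (S B : Subset n) → cnt Q S ≡ cnt Q (S ∩ B) + cnt Q (S ∩ ∁ B)
cnt-split Q []            []            = refl
cnt-split Q (outside ∷ S) (_       ∷ B) = cnt-split (Q ∘ suc) S B
cnt-split Q (inside  ∷ S) (inside  ∷ B) =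
  trans (cong (⟦ Q zero ⟧ +_) (cnt-split (Q ∘ suc) S B)) (sym (+-assoc ⟦ Q zero ⟧ _ _))
cnt-split Q (inside  ∷ S) (outside ∷ B) = begin
  q + cnt Q′ S      ≡⟨ cong (q +_) (cnt-split Q′ S B) ⟩
  q + (u + v)       ≡⟨ sym (+-assoc q u v) ⟩
  q + u + v         ≡⟨ cong (_+ v) (+-comm q u) ⟩
  u + q + v         ≡⟨ +-assoc u q v ⟩
  u + (q + v)       ∎
  where
  open ≡-Reasoning
  Q′ = Q ∘ suc
  q  = ⟦ Q zero ⟧
  u  = cnt Q′ (S ∩ B)
  v  = cnt Q′ (S ∩ ∁ B)

∣∣-sum : ∀ {n} (S : Subset n) → ∣ S ∣ ≡ sum (⟦_⟧ ∘ lookup S)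
∣∣-sum []            = refl
∣∣-sum (inside  ∷ S) = cong suc (∣∣-sum S)
∣∣-sum (outside ∷ S) = ∣∣-sum S

∣∩∣+∣∩∁∣ : ∀ {n} (S B : Subset n) → ∣ S ∣ ≡ ∣ S ∩ B ∣ + ∣ S ∩ ∁ B ∣
∣∩∣+∣∩∁∣ S B = begin
  ∣ S ∣                                                 ≡⟨ lem S ⟩
  cnt (const true) S                                    ≡⟨ cnt-split _ S B ⟩
  cnt (const true) (S ∩ B) + cnt (const true) (S ∩ ∁ B) ≡⟨ cong₂ _+_ (sym (lem (S ∩ B))) (sym (lem (S ∩ ∁ B))) ⟩
  ∣ S ∩ B ∣ + ∣ S ∩ ∁ B ∣                               ∎
  where
  open ≡-Reasoning
  lem : ∀ S → ∣ S ∣ ≡ cnt (const true) S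
  lem S = sym (trans (cnt-const true S) (*-identityʳ ∣ S ∣))

lookup-ext : ∀ {n} {A : Set} {xs ys : Vec A n} → (∀ i → lookup xs i ≡ lookup ys i) → xs ≡ ys
lookup-ext {xs = []}     {[]}     eq = refl
lookup-ext {xs = x ∷ xs} {y ∷ ys} eq = cong₂ _∷_ (eq zero) (lookup-ext (eq ∘ suc))

∖-size : ∀ {n} {x : Fin n} {S} → x ∈ S → suc ∣ S ∖ x ∣ ≡ ∣ S ∣
∖-size here = refl
∖-size {S = inside  ∷ S} (there x∈S) = cong suc (∖-size x∈S)
∖-size {S = outside ∷ S} (there x∈S) = ∖-size x∈S

∖-∉ : ∀ {n} {x : Fin n} {S} → x ∉ S → S ∖ x ≡ S
∖-∉ {x = zero}  {inside  ∷ S} x∉S = ⊥-elim (x∉S here)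
∖-∉ {x = zero}  {outside ∷ S} x∉S = refl
∖-∉ {x = suc x} {s ∷ S}       x∉S = cong (s ∷_) (∖-∉ (x∉S ∘ there))

∖-∩ : ∀ {n} (x : Fin n) (S B : Subset n) → (S ∖ x) ∩ B ≡ (S ∩ B) ∖ x
∖-∩ zero    (s ∷ S) (b ∷ B) = refl
∖-∩ (suc x) (s ∷ S) (b ∷ B) = cong (_ ∷_) (∖-∩ x S B)

∖-⊆ : ∀ {n} {x : Fin n} (S : Subset n) → S ∖ x ⊆ S
∖-⊆ {x = zero}  (s ∷ S) (there p) = there p
∖-⊆ {x = suc x} (s ∷ S) here      = here
∖-⊆ {x = suc x} (s ∷ S) (there p) = there (∖-⊆ S p)

-- Induced copies

image⁻¹-image : ∀ {m n} (π : Fin m ↔ Fin n) e → image π (image (flip π) e) ≡ e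
image⁻¹-image π e = lookup-ext λ y → begin
  lookup (image π (image (flip π) e)) y           ≡⟨ lookup∘tabulate _ y ⟩
  lookup (image (flip π) e) (Inverse.from π y)    ≡⟨ lookup∘tabulate _ (Inverse.from π y) ⟩
  lookup e (Inverse.to π (Inverse.from π y))      ≡⟨ cong (lookup e) (Inverse.strictlyInverseˡ π y) ⟩
  lookup e y                                      ∎
  where open ≡-Reasoning

∣image∣ : ∀ {m n} (π : Fin m ↔ Fin n) e → ∣ image π e ∣ ≡ ∣ e ∣
∣image∣ π e = begin
  ∣ image π e ∣                          ≡⟨ ∣∣-sum (image π e) ⟩
  sum (⟦_⟧ ∘ lookup (image π e))         ≡⟨ sum-cong (λ y → cong ⟦_⟧ (lookup∘tabulate (lookup e ∘ Inverse.from π) y)) ⟩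
  sum (⟦_⟧ ∘ lookup e ∘ Inverse.from π)  ≡⟨ sym (sum-permute +-0-commutativeMonoid (⟦_⟧ ∘ lookup e) (flip π)) ⟩
  sum (⟦_⟧ ∘ lookup e)                   ≡⟨ sym (∣∣-sum e) ⟩
  ∣ e ∣                                  ∎
  where open ≡-Reasoning

lookup-∖-≢ : ∀ {n} {x y : Fin n} (S : Subset n) → y ≢ x → lookup (S ∖ x) y ≡ lookup S y
lookup-∖-≢ S y≢x = lookup∘update′ y≢x S outside

image-∖ : ∀ {m n} (π : Fin m ↔ Fin n) e y → image π e ∖ y ≡ image π (e ∖ Inverse.from π y)
image-∖ π e y = lookup-ext λ z → trans (eq z) (sym (lookup∘tabulate _ z))
  where
  open Inverse π
  eq : ∀ z → lookup (image π e ∖ y) z ≡ lookup (e ∖ from y) (from z)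
  eq z with z Fin.≟ y
  ... | yes refl = trans (lookup∘update y (image π e) outside) (sym (lookup∘update (from y) e outside))
  ... | no z≢y   = begin
    lookup (image π e ∖ y) z         ≡⟨ lookup-∖-≢ (image π e) z≢y ⟩
    lookup (image π e) z             ≡⟨ lookup∘tabulate _ z ⟩
    lookup e (from z)                ≡⟨ sym (lookup-∖-≢ e λ p → z≢y (trans (sym (strictlyInverseˡ z)) (trans (cong to p) (strictlyInverseˡ y)))) ⟩
    lookup (e ∖ from y) (from z)     ∎
    where open ≡-Reasoning

deg-image : ∀ {m n} (P : Subset n → Bool) (π : Fin m ↔ Fin n) W → deg P (image π W) ≡ deg (P ∘ image π) W
deg-image P π W = trans
  (sum-cong λ y → cong₂ (λ b e → ⟦ b ∧ P e ⟧) (lookup∘tabulate (lookup W ∘ Inverse.from π) y) (image-∖ π W y))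
  (sym (sum-permute +-0-commutativeMonoid (λ x → ⟦ lookup W x ∧ P (image π (W ∖ x)) ⟧) (flip π)))

deg-embed : ∀ {n} (P : Subset n → Bool) (U : Subset n) W → deg P (embed U W) ≡ deg (P ∘ embed U) W
deg-embed P []            []      = refl
deg-embed P (outside ∷ U) W       = deg-embed (P ∘ (outside ∷_)) U W
deg-embed P (inside  ∷ U) (b ∷ W) = cong₂ (λ e → ⟦ b ∧ P (outside ∷ e) ⟧ +_) refl (deg-embed (P ∘ (b ∷_)) U W)

deg-cong : ∀ {n} (P R : Subset n → Bool) W → (∀ {x} → x ∈ W → P (W ∖ x) ≡ R (W ∖ x)) → deg P W ≡ deg R W
deg-cong P R W eq = cnt-cong W eq

deg-≅ : ∀ {k l m n} {H : Hypergraph k n} {F : Hypergraph l m} {U} (iso : (H [ U ]) ≅ F) V →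
  deg (edge H) (embed U V) ≡ deg (edge F) (image (_≅_.bijection iso) V)
deg-≅ {H = H} {F} {U} iso V = begin
  deg (edge H) (embed U V)                        ≡⟨ deg-embed (edge H) U V ⟩
  deg (edge (H [ U ])) V                          ≡⟨ deg-cong (edge (H [ U ])) (edge F ∘ image (_≅_.bijection iso)) V (λ {x} _ → _≅_.edges iso (V ∖ x)) ⟩
  deg (edge F ∘ image (_≅_.bijection iso)) V      ≡⟨ sym (deg-image (edge F) (_≅_.bijection iso) V) ⟩
  deg (edge F) (image (_≅_.bijection iso) V)      ∎
  where open ≡-Reasoning

-- An induced copy of `F` would contain a copy `V` of `W`, which by `deg-≅` spans as many edges as
-- `W`. One forbidden degree thus excludes `F`, whatever the rest of `F` looks like.
induced-free : ∀ {k m n} (H : Hypergraph k n) (F : Hypergraph k m) W →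
  (∀ V → ∣ V ∣ ≡ ∣ W ∣ → deg (edge H) V ≢ deg (edge F) W) → InducedFree F H
induced-free H F W avoid U iso = avoid (embed U V) (trans (∣embed∣ U V) (∣image∣ (flip π) W))
  (trans (deg-≅ {H = H} {F} iso V) (cong (deg (edge F)) (image⁻¹-image π W)))
  where
  π = _≅_.bijection iso
  V = image (flip π) W

⊆-embed : ∀ {n} {W U : Subset n} → W ⊆ U → ∃ λ V → W ≡ embed U V
⊆-embed {W = []}          {[]}          W⊆U = [] , refl
⊆-embed {W = w ∷ W}       {inside  ∷ U} W⊆U with ⊆-embed (drop-∷-⊆ W⊆U)
... | V , eq = w ∷ V , cong (w ∷_) eq
⊆-embed {W = outside ∷ W} {outside ∷ U} W⊆U with ⊆-embed (drop-∷-⊆ W⊆U)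
... | V , eq = V , cong (outside ∷_) eq
⊆-embed {W = inside  ∷ W} {outside ∷ U} W⊆U with () ← W⊆U here

-- Hypergraphs defined by a predicate on subsets

hypergraph : ∀ {n} k → (Subset n → Bool) → Hypergraph k n
edge    (hypergraph k P) e = (∣ e ∣ ≡ᵇ k) ∧ P e
uniform (hypergraph k P) e t with ∣ e ∣ ≡ᵇ k in eq
... | true = ≡ᵇ⇒≡ ∣ e ∣ k (Equivalence.from T-≡ eq)

edge-hypergraph : ∀ {n k} (P : Subset n → Bool) e → ∣ e ∣ ≡ k → edge (hypergraph k P) e ≡ P e
edge-hypergraph P e refl = cong (_∧ P e) (Equivalence.to T-≡ (≡⇒≡ᵇ ∣ e ∣ ∣ e ∣ refl))

-- Deleting a vertex of `W` leaves exactly `k` vertices, so the size test in `hypergraph` succeeds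
-- on every set that is counted.
deg-hypergraph : ∀ {n k} (P : Subset n → Bool) {W} → ∣ W ∣ ≡ suc k → deg (edge (hypergraph k P)) W ≡ deg P W
deg-hypergraph P {W} size = deg-cong (edge (hypergraph _ P)) P W λ {x} x∈W → edge-hypergraph P (W ∖ x) (suc-injective (trans (∖-size x∈W) size))

homogeneous-constant : ∀ {n k S} (P : Subset n → Bool) → Homogeneous (hypergraph k P) S →
  ∃ λ b → ∀ e → e ⊆ S → ∣ e ∣ ≡ k → P e ≡ b
homogeneous-constant P (inj₁ clique) = true , λ e e⊆S size →
  trans (sym (edge-hypergraph P e size)) (Equivalence.to T-≡ (clique e e⊆S size))
homogeneous-constant P (inj₂ independent) = false , λ e e⊆S size →
  trans (sym (edge-hypergraph P e size)) (¬-not (independent e e⊆S size ∘ Equivalence.from T-≡))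

-- Hypergraphs defined by the first split along a sequence of sets

combine : ℕ → ℕ → ℕ × ℕ → ℕ × ℕ
combine (suc a) (suc b) _ = suc a , suc b
combine _       _       r = r

-- Think of the vertices as leaves of a binary tree whose i-th level is given
-- by the i-th set: split counts the elements of e on both sides of the highest
-- vertex of the tree at which e branches (0 , 0 is a junk value).
split : ∀ {n d} → Vec (Subset n) d → Subset n → ℕ × ℕ
split []       e = 0 , 0
split (B ∷ Bs) e = combine ∣ e ∩ B ∣ ∣ e ∩ ∁ B ∣ (split Bs e)

-- `split` as a relation: a derivation records the level of the first branching, which allows
-- induction on it, and the junk value has no derivation.
data Splits {n} : ∀ {d} → Vec (Subset n) d → Subset n → ℕ → ℕ → Set where
  here  : ∀ {d B e a b} {Bs : Vec (Subset n) d} →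
          ∣ e ∩ B ∣ ≡ suc a → ∣ e ∩ ∁ B ∣ ≡ suc b → Splits (B ∷ Bs) e (suc a) (suc b)
  right : ∀ {d B e a b} {Bs : Vec (Subset n) d} → ∣ e ∩ B ∣ ≡ 0 → Splits Bs e a b → Splits (B ∷ Bs) e a b
  left  : ∀ {d B e a b} {Bs : Vec (Subset n) d} → ∣ e ∩ ∁ B ∣ ≡ 0 → Splits Bs e a b → Splits (B ∷ Bs) e a b

split-right : ∀ {n d} B (Bs : Vec (Subset n) d) e → ∣ e ∩ B ∣ ≡ 0 → split (B ∷ Bs) e ≡ split Bs e
split-right B Bs e p rewrite p = refl

split-left : ∀ {n d} B (Bs : Vec (Subset n) d) e → ∣ e ∩ ∁ B ∣ ≡ 0 → split (B ∷ Bs) e ≡ split Bs e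
split-left B Bs e p rewrite p with ∣ e ∩ B ∣
... | zero  = refl
... | suc _ = refl

split-here : ∀ {n d a b} B (Bs : Vec (Subset n) d) e →
  ∣ e ∩ B ∣ ≡ suc a → ∣ e ∩ ∁ B ∣ ≡ suc b → split (B ∷ Bs) e ≡ (suc a , suc b)
split-here B Bs e p q rewrite p | q = refl

Splits⇒split : ∀ {n d a b} (Bs : Vec (Subset n) d) e → Splits Bs e a b → split Bs e ≡ (a , b)
Splits⇒split (B ∷ Bs) e (here p q)  = split-here B Bs e p q
Splits⇒split (B ∷ Bs) e (right p s) = trans (split-right B Bs e p) (Splits⇒split Bs e s)
Splits⇒split (B ∷ Bs) e (left p s)  = trans (split-left B Bs e p) (Splits⇒split Bs e s)

-- A set of a + b vertices that splits into (a , b) has, for some α and β, exactly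
-- α + β subsets of size a + b - 1 with a split satisfying χ: removing a vertex from the
-- side of size a leaves the split (a - 1 , b), unless a = 1.
record SplitDegree (χ : ℕ → ℕ → Bool) (a b v : ℕ) : Set where
  field
    {α β} : ℕ
    sum≡  : v ≡ α + β
    α≤    : α ≤ a
    β≤    : β ≤ b
    α≡    : ∀ {a′} → a ≡ 2 + a′ → α ≡ a * ⟦ χ (1 + a′) b ⟧
    β≡    : ∀ {b′} → b ≡ 2 + b′ → β ≡ b * ⟦ χ a (1 + b′) ⟧

∩-mono-≡0 : ∀ {n} {e S : Subset n} (B : Subset n) → e ⊆ S → ∣ S ∩ B ∣ ≡ 0 → ∣ e ∩ B ∣ ≡ 0
∩-mono-≡0 {e = e} {S} B e⊆S p = n≤0⇒n≡0 (subst (∣ e ∩ B ∣ ≤_) p (p⊆q⇒∣p∣≤∣q∣ λ x∈ →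
  let x∈e , x∈B = x∈p∩q⁻ e B x∈ in x∈p∩q⁺ (e⊆S x∈e , x∈B)))

size-∖-∩ : ∀ {n a} {x : Fin n} {W B : Subset n} → x ∈ W ∩ B → ∣ W ∩ B ∣ ≡ suc a → ∣ (W ∖ x) ∩ B ∣ ≡ a
size-∖-∩ {x = x} {W} {B} x∈ p = suc-injective (trans (cong (suc ∘ ∣_∣) (∖-∩ x W B)) (trans (∖-size x∈) p))

size-∖-∉ : ∀ {n} {x : Fin n} (W B : Subset n) → x ∉ B → ∣ (W ∖ x) ∩ B ∣ ≡ ∣ W ∩ B ∣
size-∖-∉ {x = x} W B x∉B = cong ∣_∣ (trans (∖-∩ x W B) (∖-∉ (x∉B ∘ proj₂ ∘ x∈p∩q⁻ W B)))

cnt-on : ∀ {n} (Q : Fin n → Bool) (S : Subset n) c → (∀ {x} → x ∈ S → Q x ≡ c) → cnt Q S ≡ ∣ S ∣ * ⟦ c ⟧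
cnt-on Q S c eq = trans (cnt-cong S eq) (cnt-const c S)

-- Above the branching of `W` every `W ∖ x` stays on the same side as `W`, so the degree can be
-- computed at the branching, where the deletions from the two sides give `α` and `β`. Deleting the
-- only vertex of a side moves the branching further down; then only the trivial bound `α ≤ 1` or
-- `β ≤ 1` is left.
deg-split : ∀ {n d a b} (χ : ℕ → ℕ → Bool) {Bs : Vec (Subset n) d} {W} →
  Splits Bs W a b → SplitDegree χ a b (deg (uncurry χ ∘ split Bs) W)
deg-split χ {B ∷ Bs} {W} (right p s) = subst (SplitDegree χ _ _)
  (deg-cong (uncurry χ ∘ split Bs) (uncurry χ ∘ split (B ∷ Bs)) W λ {x} _ →
    cong (uncurry χ) (sym (split-right B Bs (W ∖ x) (∩-mono-≡0 B (∖-⊆ W) p)))) (deg-split χ s)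
deg-split χ {B ∷ Bs} {W} (left p s) = subst (SplitDegree χ _ _)
  (deg-cong (uncurry χ ∘ split Bs) (uncurry χ ∘ split (B ∷ Bs)) W λ {x} _ →
    cong (uncurry χ) (sym (split-left B Bs (W ∖ x) (∩-mono-≡0 (∁ B) (∖-⊆ W) p)))) (deg-split χ s)
deg-split χ {B ∷ Bs} {W} (here {a = a} {b} p q) = record
  { sum≡ = cnt-split Q W B
  ; α≤   = subst (cnt Q (W ∩ B) ≤_) p (cnt-≤ Q (W ∩ B))
  ; β≤   = subst (cnt Q (W ∩ ∁ B) ≤_) q (cnt-≤ Q (W ∩ ∁ B))
  ; α≡   = λ { refl → trans (cnt-on Q (W ∩ B) _ λ {x} x∈ → cong (uncurry χ)
             (split-here B Bs (W ∖ x) (size-∖-∩ {W = W} {B} x∈ p)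
               (trans (size-∖-∉ W (∁ B) (x∈p⇒x∉∁p (proj₂ (x∈p∩q⁻ W B x∈)))) q))) (cong (_* _) p) }
  ; β≡   = λ { refl → trans (cnt-on Q (W ∩ ∁ B) _ λ {x} x∈ → cong (uncurry χ)
             (split-here B Bs (W ∖ x)
               (trans (size-∖-∉ W B (x∈∁p⇒x∉p (proj₂ (x∈p∩q⁻ W (∁ B) x∈)))) p)
               (size-∖-∩ {W = W} {∁ B} x∈ q))) (cong (_* _) q) }
  }
  where
  Q : _ → Bool
  Q x = uncurry χ (split (B ∷ Bs) (W ∖ x))

pick : ∀ {n} (N B : Subset n) {i j} → i ≤ ∣ N ∩ B ∣ → j ≤ ∣ N ∩ ∁ B ∣ →
  ∃ λ e → e ⊆ N × ∣ e ∩ B ∣ ≡ i × ∣ e ∩ ∁ B ∣ ≡ j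
pick [] [] z≤n z≤n = [] , id , refl , refl
pick (outside ∷ N) (_ ∷ B) i≤ j≤ with pick N B i≤ j≤
... | e , e⊆N , p , q = outside ∷ e , out⊆ e⊆N , p , q
pick (inside ∷ N) (inside ∷ B) {zero} i≤ j≤ with pick N B z≤n j≤
... | e , e⊆N , p , q = outside ∷ e , out⊆ e⊆N , p , q
pick (inside ∷ N) (inside ∷ B) {suc i} (s≤s i≤) j≤ with pick N B i≤ j≤
... | e , e⊆N , p , q = inside ∷ e , in⊆in e⊆N , cong suc p , q
pick (inside ∷ N) (outside ∷ B) {j = zero} i≤ j≤ with pick N B i≤ z≤n
... | e , e⊆N , p , q = outside ∷ e , out⊆ e⊆N , p , q
pick (inside ∷ N) (outside ∷ B) {j = suc j} i≤ (s≤s j≤) with pick N B i≤ j≤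
... | e , e⊆N , p , q = inside ∷ e , in⊆in e⊆N , p , cong suc q

-- A subset that keeps a vertex on each side branches where `N` does.
pick-split : ∀ {n d a b i j} {Bs : Vec (Subset n) d} {N} → Splits Bs N a b → suc i ≤ a → suc j ≤ b →
  ∃ λ e → e ⊆ N × ∣ e ∣ ≡ suc i + suc j × Splits Bs e (suc i) (suc j)
pick-split {Bs = B ∷ Bs} {N} (here p q) i≤ j≤
  with pick N B (subst (_ ≤_) (sym p) i≤) (subst (_ ≤_) (sym q) j≤)
... | e , e⊆N , p′ , q′ = e , e⊆N , trans (∣∩∣+∣∩∁∣ e B) (cong₂ _+_ p′ q′) , here p′ q′
pick-split {Bs = B ∷ Bs} (right p s) i≤ j≤ with pick-split s i≤ j≤
... | e , e⊆N , size , s′ = e , e⊆N , size , right (∩-mono-≡0 B e⊆N p) s′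
pick-split {Bs = B ∷ Bs} (left p s) i≤ j≤ with pick-split s i≤ j≤
... | e , e⊆N , size , s′ = e , e⊆N , size , left (∩-mono-≡0 (∁ B) e⊆N p) s′

-- Branchings of sets of separated vertices

Separates : ∀ {n d} → Vec (Subset n) d → Subset n → Set
Separates Bs S = ∀ {x y} → x ∈ S → y ∈ S → (∀ i → lookup (lookup Bs i) x ≡ lookup (lookup Bs i) y) → x ≡ y

∣S∣≡0⇒∉ : ∀ {n} {S : Subset n} {x} → ∣ S ∣ ≡ 0 → x ∉ S
∣S∣≡0⇒∉ p x∈S with () ← trans (sym p) (sym (∖-size x∈S))

Nonempty-size : ∀ {n} (S : Subset n) {s} → ∣ S ∣ ≡ suc s → ∃ λ x → x ∈ S
Nonempty-size (inside  ∷ S) p = zero , here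
Nonempty-size (outside ∷ S) p with Nonempty-size S p
... | x , x∈S = suc x , there x∈S

unique⇒∣∣≤1 : ∀ {n} (S : Subset n) → (∀ {x y} → x ∈ S → y ∈ S → x ≡ y) → ∣ S ∣ ≤ 1
unique⇒∣∣≤1 []            u = z≤n
unique⇒∣∣≤1 (outside ∷ S) u = unique⇒∣∣≤1 S λ x∈ y∈ → Fin.suc-injective (u (there x∈) (there y∈))
unique⇒∣∣≤1 (inside  ∷ S) u with ∣ S ∣ in eq
... | zero  = s≤s z≤n
... | suc _ with x , x∈S ← Nonempty-size S eq with () ← u here (there x∈S)

∉⇒lookup : ∀ {n} {x : Fin n} (S : Subset n) → x ∉ S → lookup S x ≡ outside
∉⇒lookup {x = x} S x∉S = ¬-not λ p → x∉S (lookup⇒[]= x S p)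

Separates-∷ : ∀ {n d} B {Bs : Vec (Subset n) d} {S} → (∀ {x y} → x ∈ S → y ∈ S → lookup B x ≡ lookup B y) →
  Separates (B ∷ Bs) S → Separates Bs S
Separates-∷ B const sep x∈ y∈ eq = sep x∈ y∈ λ { zero → const x∈ y∈ ; (suc i) → eq i }

∩-empty : ∀ {n} (S B : Subset n) → ∣ S ∩ B ∣ ≡ 0 → ∀ {x} → x ∈ S → lookup B x ≡ outside
∩-empty S B p x∈S = ∉⇒lookup B λ x∈B → ∣S∣≡0⇒∉ p (x∈p∩q⁺ (x∈S , x∈B))

∩∁-empty : ∀ {n} (S B : Subset n) → ∣ S ∩ ∁ B ∣ ≡ 0 → ∀ {x} → x ∈ S → lookup B x ≡ inside
∩∁-empty S B p {x} x∈S = []=⇒lookup (x∉∁p⇒x∈p λ x∈∁B → ∣S∣≡0⇒∉ p (x∈p∩q⁺ (x∈S , x∈∁B)))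

Separates-right : ∀ {n d} B {Bs : Vec (Subset n) d} S → ∣ S ∩ B ∣ ≡ 0 → Separates (B ∷ Bs) S → Separates Bs S
Separates-right B S p = Separates-∷ B λ x∈ y∈ → trans (∩-empty S B p x∈) (sym (∩-empty S B p y∈))

Separates-left : ∀ {n d} B {Bs : Vec (Subset n) d} S → ∣ S ∩ ∁ B ∣ ≡ 0 → Separates (B ∷ Bs) S → Separates Bs S
Separates-left B S p = Separates-∷ B λ x∈ y∈ → trans (∩∁-empty S B p x∈) (sym (∩∁-empty S B p y∈))

Separates-⊆ : ∀ {n d} {Bs : Vec (Subset n) d} {S S′} → S′ ⊆ S → Separates Bs S → Separates Bs S′
Separates-⊆ S′⊆S sep x∈ y∈ = sep (S′⊆S x∈) (S′⊆S y∈)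

-- By separation, at most one vertex can survive all levels without a branching. Hence `split` does
-- not take its junk value on such a `W`.
splits : ∀ {n d} (Bs : Vec (Subset n) d) W → Separates Bs W → 2 ≤ ∣ W ∣ →
  ∃ λ a → ∃ λ b → Splits Bs W (suc a) (suc b) × suc a + suc b ≡ ∣ W ∣
splits []       W sep 2≤ = ⊥-elim (<⇒≱ 2≤ (unique⇒∣∣≤1 W λ x∈ y∈ → sep x∈ y∈ λ ()))
splits (B ∷ Bs) W sep 2≤ with ∣ W ∩ B ∣ in p | ∣ W ∩ ∁ B ∣ in q
... | suc a | suc b = a , b , here p q , sym (trans (∣∩∣+∣∩∁∣ W B) (cong₂ _+_ p q))
... | zero  | _     with a , b , s , eq ← splits Bs W (Separates-right B W p sep) 2≤ = a , b , right p s , eq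
... | suc _ | zero  with a , b , s , eq ← splits Bs W (Separates-left B W q sep) 2≤ = a , b , left q s , eq

∣∩B∩∁B∣ : ∀ {n} (S B : Subset n) → ∣ (S ∩ B) ∩ ∁ B ∣ ≡ 0
∣∩B∩∁B∣ []            []            = refl
∣∩B∩∁B∣ (outside ∷ S) (_       ∷ B) = ∣∩B∩∁B∣ S B
∣∩B∩∁B∣ (inside  ∷ S) (outside ∷ B) = ∣∩B∩∁B∣ S B
∣∩B∩∁B∣ (inside  ∷ S) (inside  ∷ B) = ∣∩B∩∁B∣ S B

∣∩∁B∩B∣ : ∀ {n} (S B : Subset n) → ∣ (S ∩ ∁ B) ∩ B ∣ ≡ 0
∣∩∁B∩B∣ []            []            = refl
∣∩∁B∩B∣ (outside ∷ S) (_       ∷ B) = ∣∩∁B∩B∣ S B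
∣∩∁B∩B∣ (inside  ∷ S) (outside ∷ B) = ∣∩∁B∩B∣ S B
∣∩∁B∩B∣ (inside  ∷ S) (inside  ∷ B) = ∣∩∁B∩B∣ S B

-- If at every branching of S one side has at most M vertices, then following the
-- other sides loses at most M vertices at each of the d levels.
balanced-split : ∀ {n d} M (Bs : Vec (Subset n) d) S → Separates Bs S → d * M + 1 ℕ.< ∣ S ∣ →
  ∃ λ N → N ⊆ S × ∃ λ a → ∃ λ b → Splits Bs N a b × M ℕ.< a × M ℕ.< b
balanced-split M []       S sep big = ⊥-elim (<⇒≱ big (unique⇒∣∣≤1 S λ x∈ y∈ → sep x∈ y∈ λ ()))
balanced-split {d = suc d} M (B ∷ Bs) S sep big with ∣ S ∩ B ∣ ℕ.≤? M | ∣ S ∩ ∁ B ∣ ℕ.≤? M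
... | yes p | _ = let N , N⊆ , a , b , s , M<a , M<b = balanced-split M Bs (S ∩ ∁ B)
                        (Separates-right B (S ∩ ∁ B) (∣∩∁B∩B∣ S B) (Separates-⊆ {Bs = B ∷ Bs} (p∩q⊆p S (∁ B)) sep)) big′
                  in N , p∩q⊆p S (∁ B) ∘ N⊆ , a , b , right (∩-mono-≡0 B N⊆ (∣∩∁B∩B∣ S B)) s , M<a , M<b
  where
  big′ : d * M + 1 ℕ.< ∣ S ∩ ∁ B ∣
  big′ = +-cancelˡ-< M _ _ (<-≤-trans (subst (ℕ._< ∣ S ∣) (+-assoc M (d * M) 1) big)
           (≤-trans (≤-reflexive (∣∩∣+∣∩∁∣ S B)) (+-monoˡ-≤ ∣ S ∩ ∁ B ∣ p)))
... | no _ | yes q = let N , N⊆ , a , b , s , M<a , M<b = balanced-split M Bs (S ∩ B)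
                           (Separates-left B (S ∩ B) (∣∩B∩∁B∣ S B) (Separates-⊆ {Bs = B ∷ Bs} (p∩q⊆p S B) sep)) big′
                     in N , p∩q⊆p S B ∘ N⊆ , a , b , left (∩-mono-≡0 (∁ B) N⊆ (∣∩B∩∁B∣ S B)) s , M<a , M<b
  where
  big′ : d * M + 1 ℕ.< ∣ S ∩ B ∣
  big′ = +-cancelˡ-< M _ _ (<-≤-trans (subst (ℕ._< ∣ S ∣) (+-assoc M (d * M) 1) big)
           (≤-trans (≤-reflexive (trans (∣∩∣+∣∩∁∣ S B) (+-comm ∣ S ∩ B ∣ _))) (+-monoˡ-≤ ∣ S ∩ B ∣ q)))
... | no p | no q with ∣ S ∩ B ∣ in eqa | ∣ S ∩ ∁ B ∣ in eqb
...   | suc a | suc b = S , id , suc a , suc b , here eqa eqb , ≰⇒> p , ≰⇒> q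
...   | zero  | _     = ⊥-elim (p z≤n)
...   | suc _ | zero  = ⊥-elim (q z≤n)

-- The tree of binary digits

isOne : Fin 2 → Bool
isOne zero    = false
isOne (suc _) = true

isOne-injective : ∀ {i j} → isOne i ≡ isOne j → i ≡ j
isOne-injective {zero}     {zero}     _ = refl
isOne-injective {suc zero} {suc zero} _ = refl

-- The `i`-th set holds the vertices whose `i`-th binary digit is one: a vertex is the leaf whose
-- address is its string of digits.
bits : ∀ {n} d → n ≤ 2 ^ d → Vec (Subset n) d
bits d n≤ = tabulate λ i → tabulate λ x → isOne (finToFun {2} {d} (inject≤ x n≤) i)

funToFin-cong : ∀ {m d} {f g : Fin d → Fin m} → (∀ i → f i ≡ g i) → funToFin f ≡ funToFin g
funToFin-cong {d = zero}  eq = refl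
funToFin-cong {d = suc d} eq = cong₂ Fin.combine (eq zero) (funToFin-cong (eq ∘ suc))

bits-separate : ∀ {n} d (n≤ : n ≤ 2 ^ d) S → Separates (bits d n≤) S
bits-separate d n≤ S {x} {y} _ _ eq = inject≤-injective n≤ n≤ x y (begin
  inject≤ x n≤                                  ≡⟨ sym (funToFin-finToFin {d} {2} (inject≤ x n≤)) ⟩
  funToFin (finToFun {2} {d} (inject≤ x n≤))    ≡⟨ funToFin-cong (λ i → isOne-injective (trans (sym (bit i x)) (trans (eq i) (bit i y)))) ⟩
  funToFin (finToFun {2} {d} (inject≤ y n≤))    ≡⟨ funToFin-finToFin {d} {2} (inject≤ y n≤) ⟩
  inject≤ y n≤                                  ∎)
  where
  open ≡-Reasoning
  bit : ∀ i z → lookup (lookup (bits d n≤) i) z ≡ isOne (finToFun {2} {d} (inject≤ z n≤) i)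
  bit i z = trans (cong (λ B → lookup B z) (lookup∘tabulate _ i)) (lookup∘tabulate _ z)

-- Homogeneous sets of hypergraphs given by splits

splitHypergraph : ∀ {n d} k → (ℕ → ℕ → Bool) → Vec (Subset n) d → Hypergraph k n
splitHypergraph k χ Bs = hypergraph k (uncurry χ ∘ split Bs)

-- A larger `S` has a branching with more than `3 + k` vertices on each side, hence contains sets of
-- both types `(1 , 2 + k)` and `(2 , 1 + k)`, which `χ` treats differently.
splitHypergraph-homogeneous : ∀ {n d} k χ (Bs : Vec (Subset n) d) → (∀ S → Separates Bs S) → χ 1 (2 + k) ≢ χ 2 (1 + k) →
  ∀ S → Homogeneous (splitHypergraph (3 + k) χ Bs) S → ∣ S ∣ ≤ d * (3 + k) + 1
splitHypergraph-homogeneous {d = d} k χ Bs sep χ≢ S hom = ≮⇒≥ λ big →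
  let N , N⊆S , _ , _ , s , M<a , M<b = balanced-split (3 + k) Bs S (sep S) big
      e , e⊆N , size , t = pick-split {i = 0} {1 + k} s (≤-trans (s≤s z≤n) M<a) (≤-trans (m≤n+m (2 + k) 2) M<b)
      e′ , e′⊆N , size′ , t′ = pick-split {i = 1} {k} s (≤-trans (s≤s (s≤s z≤n)) M<a) (≤-trans (m≤n+m (1 + k) 3) M<b)
  in χ≢ (trans (value e (N⊆S ∘ e⊆N) size t) (sym (value e′ (N⊆S ∘ e′⊆N) size′ t′)))
  where
  constant : ∃ λ c → ∀ e → e ⊆ S → ∣ e ∣ ≡ 3 + k → uncurry χ (split Bs e) ≡ c
  constant = homogeneous-constant (uncurry χ ∘ split Bs) hom

  value : ∀ {a b} e → e ⊆ S → ∣ e ∣ ≡ 3 + k → Splits Bs e a b → χ a b ≡ proj₁ constant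
  value e e⊆S size t = trans (cong (uncurry χ) (sym (Splits⇒split Bs e t))) (proj₂ constant e e⊆S size)

-- With ℓ the integral part of log₂ n.
PolylogHomogeneous : ∀ {k m} → Hypergraph k m → Set
PolylogHomogeneous {k} F = ∃ λ L → ∀ ℓ n → L ≤ ℓ → n ≤ 2 ^ suc ℓ →
  ∃ λ (H : Hypergraph k n) → InducedFree F H × (∀ S → Homogeneous H S → ∣ S ∣ ≤ ℓ ^ 4)

square≤^4 : ∀ {ℓ} → 1 ≤ ℓ → ℓ * ℓ ≤ ℓ ^ 4
square≤^4 {ℓ@(suc _)} _ = ≤-trans (≤-reflexive (cong (ℓ *_) (sym (*-identityʳ ℓ)))) (^-monoʳ-≤ ℓ {2} {4} (s≤s (s≤s z≤n)))

-- The left side is the bound of `splitHypergraph-homogeneous` for `suc ℓ` levels; `k` stands for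
-- the whole uniformity.
linear≤^4 : ∀ ℓ k → suc k ≤ ℓ → suc ℓ * k + 1 ≤ ℓ ^ 4
linear≤^4 ℓ k k<ℓ = begin
  suc ℓ * k + 1      ≡⟨ +-comm (suc ℓ * k) 1 ⟩
  suc k + ℓ * k      ≤⟨ +-monoˡ-≤ (ℓ * k) k<ℓ ⟩
  ℓ + ℓ * k          ≡⟨ sym (*-suc ℓ k) ⟩
  ℓ * suc k          ≤⟨ *-monoʳ-≤ ℓ k<ℓ ⟩
  ℓ * ℓ              ≤⟨ square≤^4 (≤-trans (s≤s z≤n) k<ℓ) ⟩
  ℓ ^ 4              ∎
  where open ≤-Reasoning

polylog-by-splits : ∀ {k m} (F : Hypergraph (3 + k) m) χ → χ 1 (2 + k) ≢ χ 2 (1 + k) →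
  (∀ {n d} (Bs : Vec (Subset n) d) → (∀ S → Separates Bs S) → InducedFree F (splitHypergraph (3 + k) χ Bs)) →
  PolylogHomogeneous F
polylog-by-splits {k} F χ χ≢ free = 4 + k , λ ℓ n L≤ℓ n≤ →
  let sep = bits-separate (suc ℓ) n≤
      Bs  = bits (suc ℓ) n≤ in
  splitHypergraph (3 + k) χ Bs , free Bs sep ,
  λ S hom → ≤-trans (splitHypergraph-homogeneous k χ Bs sep χ≢ S hom) (linear≤^4 ℓ (3 + k) L≤ℓ)

splits-avoid : ∀ {k m n d} (F : Hypergraph (3 + k) m) W → ∣ W ∣ ≡ 4 + k → ∀ χ →
  (∀ {a b v} → suc a + suc b ≡ 4 + k → SplitDegree χ (suc a) (suc b) v → v ≢ deg (edge F) W) →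
  (Bs : Vec (Subset n) d) → (∀ S → Separates Bs S) → InducedFree F (splitHypergraph (3 + k) χ Bs)
splits-avoid F W size χ avoid Bs sep = induced-free (splitHypergraph _ χ Bs) F W λ V size′ eq →
  let size″ = trans size′ size
      a , b , s , ab = splits Bs V (sep V) (subst (2 ≤_) (sym size″) (s≤s (s≤s z≤n)))
  in avoid (trans ab size″) (deg-split χ s) (trans (sym (deg-hypergraph (uncurry χ ∘ split Bs) size″)) eq)

-- Uniformity at least four

-- In uniformity `4 + k`, `bothTwo` permits only the degrees 0, 1, `3 + k` and `5 + k` of a set of
-- `5 + k` vertices. Of these, `leftTwo` excludes `5 + k`, and `notLeftTwo` excludes the other
-- three.
bothTwo leftTwo notLeftTwo : ℕ → ℕ → Bool
bothTwo    a b = (2 ≤ᵇ a) ∧ (2 ≤ᵇ b)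
leftTwo    a b = a ≡ᵇ 2
notLeftTwo a b = not (a ≡ᵇ 2)


-- If a vertex is alone on its side, only its own deletion can leave an edge. If a side has two
-- vertices, exactly the `3 + k` deletions from the other side leave edges; if both have at least
-- three, all deletions do.
bothTwo-degrees : ∀ {k a b v} → suc a + suc b ≡ 5 + k → SplitDegree bothTwo (suc a) (suc b) v →
  v ≤ 1 ⊎ v ≡ 3 + k ⊎ v ≡ 5 + k
bothTwo-degrees {a = 0} {suc b} ab s = let open SplitDegree s in
  inj₁ (≤-trans (≤-reflexive (trans sum≡ (trans (cong (α +_) (trans (β≡ refl) (*-zeroʳ (2 + b)))) (+-identityʳ α)))) α≤)
bothTwo-degrees {a = suc a} {0} ab s = let open SplitDegree s in
  inj₁ (≤-trans (≤-reflexive (trans sum≡ (cong (_+ β) (trans (α≡ refl) (trans (cong (λ z → (2 + a) * ⟦ z ⟧) (∧-zeroʳ (2 ≤ᵇ 1 + a))) (*-zeroʳ (2 + a))))))) β≤)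
bothTwo-degrees {a = 1} {suc (suc b)} refl s = let open SplitDegree s in
  inj₂ (inj₁ (trans sum≡ (trans (cong₂ _+_ (α≡ refl) (β≡ refl)) (*-identityʳ (3 + b)))))
bothTwo-degrees {a = suc (suc a)} {1} ab s = let open SplitDegree s in
  inj₂ (inj₁ (trans sum≡ (trans (cong₂ _+_ (trans (α≡ refl) (*-identityʳ (3 + a))) (β≡ refl))
    (trans (+-identityʳ (3 + a)) (+-cancelʳ-≡ 2 _ _ (trans ab (+-comm 2 (3 + _))))))))
bothTwo-degrees {a = suc (suc a)} {suc (suc b)} ab s = let open SplitDegree s in
  inj₂ (inj₂ (trans sum≡ (trans (cong₂ _+_ (trans (α≡ refl) (*-identityʳ (3 + a))) (trans (β≡ refl) (*-identityʳ (3 + b)))) ab)))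

-- A left side of two vertices gives the `3 + k` deletions on the right, one of three gives its own
-- three deletions. In all other cases only the deletion of a vertex alone on its side can leave an
-- edge.
leftTwo-degrees : ∀ {k a b v} → suc a + suc b ≡ 5 + k → SplitDegree leftTwo (suc a) (suc b) v →
  v ≤ 3 + k
leftTwo-degrees {a = 0} {suc b} ab s = let open SplitDegree s in
  ≤-trans (≤-reflexive (trans sum≡ (trans (cong (α +_) (trans (β≡ refl) (*-zeroʳ (2 + b)))) (+-identityʳ α)))) (≤-trans α≤ (s≤s z≤n))
leftTwo-degrees {a = 1} {suc b} refl s = let open SplitDegree s in
  ≤-reflexive (trans sum≡ (trans (cong₂ _+_ (α≡ refl) (β≡ refl)) (*-identityʳ (2 + b))))
leftTwo-degrees {a = 2} {suc b} ab s = let open SplitDegree s in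
  ≤-trans (≤-reflexive (trans sum≡ (cong₂ _+_ (α≡ refl) (trans (β≡ refl) (*-zeroʳ (2 + b)))))) (m≤m+n 3 _)
leftTwo-degrees {a = suc (suc (suc a))} {b} ab s = let open SplitDegree s in
  ≤-trans (≤-reflexive (trans sum≡ (cong (_+ β) (trans (α≡ refl) (*-zeroʳ (4 + a)))))) (≤-trans (β≤1 s) (s≤s z≤n))
  where
  β≤1 : ∀ {b v} (s : SplitDegree leftTwo (4 + a) (suc b) v) → SplitDegree.β s ≤ 1
  β≤1 {0}     s = SplitDegree.β≤ s
  β≤1 {suc b} s = ≤-trans (≤-reflexive (trans (SplitDegree.β≡ s refl) (*-zeroʳ (2 + b)))) z≤n

-- The complementary count: a left side of two vertices gives 2, one of three gives `2 + k`. In all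
-- other cases every deletion leaves an edge, except perhaps that of a vertex alone on its side.
notLeftTwo-degrees : ∀ {k a b v} → suc a + suc b ≡ 5 + k → SplitDegree notLeftTwo (suc a) (suc b) v →
  4 + k ≤ v ⊎ v ≡ 2 ⊎ v ≡ 2 + k
notLeftTwo-degrees {a = 0} {suc b} refl s = let open SplitDegree s in
  inj₁ (≤-trans (≤-reflexive (sym (trans (β≡ refl) (*-identityʳ (2 + b))))) (≤-trans (m≤n+m β α) (≤-reflexive (sym sum≡))))
notLeftTwo-degrees {a = 1} {suc b} ab s = let open SplitDegree s in
  inj₂ (inj₁ (trans sum≡ (cong₂ _+_ (α≡ refl) (trans (β≡ refl) (*-zeroʳ (2 + b))))))
notLeftTwo-degrees {a = 2} {suc b} refl s = let open SplitDegree s in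
  inj₂ (inj₂ (trans sum≡ (cong₂ _+_ (α≡ refl) (trans (β≡ refl) (*-identityʳ (2 + b))))))
notLeftTwo-degrees {k} {suc (suc (suc a))} {0} ab s = let open SplitDegree s in
  inj₁ (≤-trans (≤-reflexive (trans (sym (+-cancelʳ-≡ 1 _ _ (trans ab (+-comm 1 (4 + k))))) (sym (trans (α≡ refl) (*-identityʳ (4 + a))))))
    (≤-trans (m≤m+n α β) (≤-reflexive (sym sum≡))))
notLeftTwo-degrees {k} {suc (suc (suc a))} {suc b} ab s = let open SplitDegree s in
  inj₁ (≤-trans (n≤1+n (4 + k)) (≤-reflexive (sym (trans sum≡
    (trans (cong₂ _+_ (trans (α≡ refl) (*-identityʳ (4 + a))) (trans (β≡ refl) (*-identityʳ (2 + b)))) ab)))))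

pick-size : ∀ {n} i (S : Subset n) → i ≤ ∣ S ∣ → ∃ λ e → e ⊆ S × ∣ e ∣ ≡ i
pick-size zero    []            _       = [] , id , refl
pick-size i       (outside ∷ S) i≤      with e , e⊆S , p ← pick-size i S i≤ = outside ∷ e , out⊆ e⊆S , p
pick-size zero    (inside  ∷ S) i≤      with e , e⊆S , p ← pick-size 0 S z≤n = outside ∷ e , out⊆ e⊆S , p
pick-size (suc i) (inside  ∷ S) (s≤s i≤) with e , e⊆S , p ← pick-size i S i≤ = inside ∷ e , in⊆in e⊆S , cong suc p

uniformity≥4 : ∀ {k m} (F : Hypergraph (4 + k) m) → 5 + k ≤ m → PolylogHomogeneous F
uniformity≥4 {k} {m} F m≥ with W , _ , size ← pick-size (5 + k) ⊤ (subst (5 + k ≤_) (sym (∣⊤∣≡n m)) m≥) = go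
  where
  f = deg (edge F) W

  by : ∀ χ → χ 1 (3 + k) ≢ χ 2 (2 + k) →
    (∀ {a b v} → suc a + suc b ≡ 5 + k → SplitDegree χ (suc a) (suc b) v → v ≢ f) → PolylogHomogeneous F
  by χ χ≢ avoid = polylog-by-splits F χ χ≢ (splits-avoid F W size χ avoid)

  use-notLeftTwo : f ≤ 1 ⊎ f ≡ 3 + k → PolylogHomogeneous F
  use-notLeftTwo f? = by notLeftTwo (λ ()) λ { {v = v} ab s refl → contra f? (notLeftTwo-degrees ab s) }
    where
    contra : f ≤ 1 ⊎ f ≡ 3 + k → ¬ (4 + k ≤ f ⊎ f ≡ 2 ⊎ f ≡ 2 + k)
    contra (inj₁ p) (inj₁ q)        = <⇒≱ (≤-trans (s≤s (s≤s z≤n)) q) p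
    contra (inj₁ p) (inj₂ (inj₁ q)) = <⇒≱ (≤-reflexive (sym q)) p
    contra (inj₁ p) (inj₂ (inj₂ q)) = <⇒≱ (≤-trans (s≤s (s≤s z≤n)) (≤-reflexive (sym q))) p
    contra (inj₂ p) (inj₁ q)        = <⇒≱ q (≤-reflexive p)
    contra (inj₂ p) (inj₂ (inj₁ q)) with () ← trans (sym p) q
    contra (inj₂ p) (inj₂ (inj₂ q)) = 1+n≢n (trans (sym p) q)

  go : PolylogHomogeneous F
  go with f ≟ 5 + k | f ≟ 3 + k | f ℕ.≤? 1
  ... | yes p | _     | _     = by leftTwo (λ ()) λ ab s q →
    <⇒≱ (n≤1+n (4 + k)) (subst (_≤ 3 + k) (trans q p) (leftTwo-degrees ab s))
  ... | no _  | yes p | _     = use-notLeftTwo (inj₂ p)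
  ... | no _  | no _  | yes p = use-notLeftTwo (inj₁ p)
  ... | no p  | no q  | no r  = by bothTwo (λ ()) λ { ab s refl → [ r , [ q , p ]′ ]′ (bothTwo-degrees ab s) }

-- Unions of few unlikely events

-- A vector over `Maybe Bool` encodes the event that certain bits of a random vector have prescribed
-- values; `nothing` leaves a bit free.
data Agrees : Maybe Bool → Bool → Set where
  free   : ∀ {b} → Agrees nothing b
  forced : ∀ {b} → Agrees (just b) b

Matches : ∀ {N} → Vec (Maybe Bool) N → Vec Bool N → Set
Matches = Pointwise Agrees

weight : ∀ {N} → Vec (Maybe Bool) N → ℕ
weight []            = 1
weight (nothing ∷ c) = weight c + weight c
weight (just _  ∷ c) = weight c

totalWeight : ∀ {N} → List (Vec (Maybe Bool) N) → ℕ
totalWeight []       = 0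
totalWeight (c ∷ cs) = weight c + totalWeight cs

-- Conditioning on the first bit: events that contradict it are dropped, the others become events
-- about the remaining bits.
restrict : ∀ {N} → Bool → List (Vec (Maybe Bool) (suc N)) → List (Vec (Maybe Bool) N)
restrict b     []                       = []
restrict b     ((nothing    ∷ c) ∷ cs) = c ∷ restrict b cs
restrict true  ((just true  ∷ c) ∷ cs) = c ∷ restrict true cs
restrict true  ((just false ∷ c) ∷ cs) = restrict true cs
restrict false ((just true  ∷ c) ∷ cs) = restrict false cs
restrict false ((just false ∷ c) ∷ cs) = c ∷ restrict false cs

-- An event with a free first bit contributes half of its weight to either value, any other event
-- all of it to one value. So if the total is below `2 ^ suc N`, one of the two values leaves less
-- than `2 ^ N`.
restrict-weight : ∀ {N} (cs : List (Vec (Maybe Bool) (suc N))) →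
  totalWeight (restrict true cs) + totalWeight (restrict false cs) ≡ totalWeight cs
restrict-weight [] = refl
restrict-weight ((nothing ∷ c) ∷ cs) =
  trans (interchange (weight c) _ (weight c) _) (cong (weight c + weight c +_) (restrict-weight cs))
  where
  interchange : ∀ a b c d → (a + b) + (c + d) ≡ (a + c) + (b + d)
  interchange = solve-∀
restrict-weight ((just true ∷ c) ∷ cs) =
  trans (+-assoc (weight c) _ _) (cong (weight c +_) (restrict-weight cs))
restrict-weight ((just false ∷ c) ∷ cs) =
  trans (swap (totalWeight (restrict true cs)) (weight c) _) (cong (weight c +_) (restrict-weight cs))
  where
  swap : ∀ a b c → a + (b + c) ≡ b + (a + c)
  swap = solve-∀

restrict-Matches : ∀ {N b v} (cs : List (Vec (Maybe Bool) (suc N))) →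
  All (λ c → ¬ Matches c v) (restrict b cs) → All (λ c → ¬ Matches c (b ∷ v)) cs
restrict-Matches             []                       _        = []
restrict-Matches             ((nothing    ∷ c) ∷ cs) (¬m ∷ a) = (λ { (_ ∷ m) → ¬m m }) ∷ restrict-Matches cs a
restrict-Matches {b = true}  ((just true  ∷ c) ∷ cs) (¬m ∷ a) = (λ { (_ ∷ m) → ¬m m }) ∷ restrict-Matches cs a
restrict-Matches {b = true}  ((just false ∷ c) ∷ cs) a        = (λ { (() ∷ _) }) ∷ restrict-Matches cs a
restrict-Matches {b = false} ((just true  ∷ c) ∷ cs) a        = (λ { (() ∷ _) }) ∷ restrict-Matches cs a
restrict-Matches {b = false} ((just false ∷ c) ∷ cs) (¬m ∷ a) = (λ { (_ ∷ m) → ¬m m }) ∷ restrict-Matches cs a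

-- The method of conditional expectations: the weight of c is 2 ^ N times the probability
-- that a uniformly random v matches c.
avoid-all : ∀ N (cs : List (Vec (Maybe Bool) N)) → totalWeight cs ℕ.< 2 ^ N →
  ∃ λ (v : Vec Bool N) → All (λ c → ¬ Matches c v) cs
avoid-all zero    []        _ = [] , []
avoid-all zero    ([] ∷ cs) (s≤s ())
avoid-all (suc N) cs        w with totalWeight (restrict true cs) ℕ.<? 2 ^ N
... | yes p = let v , a = avoid-all N (restrict true cs) p in true ∷ v , restrict-Matches cs a
... | no p  = let v , a = avoid-all N (restrict false cs) q in false ∷ v , restrict-Matches cs a
  where
  q : totalWeight (restrict false cs) ℕ.< 2 ^ N
  q = +-cancelˡ-< (2 ^ N) _ _ (≤-<-trans (+-monoˡ-≤ _ (≮⇒≥ p))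
        (subst₂ ℕ._<_ (sym (restrict-weight cs)) (cong (2 ^ N +_) (+-identityʳ (2 ^ N))) w))

-- Colourings of pairs

elements : ∀ {n} → Subset n → List (Fin n)
elements []            = []
elements (outside ∷ S) = List.map suc (elements S)
elements (inside  ∷ S) = zero ∷ List.map suc (elements S)

length-elements : ∀ {n} (S : Subset n) → length (elements S) ≡ ∣ S ∣
length-elements []            = refl
length-elements (outside ∷ S) = trans (length-map suc (elements S)) (length-elements S)
length-elements (inside  ∷ S) = cong suc (trans (length-map suc (elements S)) (length-elements S))

-- The binomial coefficient `n` over 2, so that a colouring of the pairs is a vector of `tri n`
-- bits.
tri : ℕ → ℕ
tri zero    = 0
tri (suc n) = n + tri n

-- The first `n` bits belong to the pairs that contain `zero`. Only increasing pairs carry a colour;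
-- `false` is a default for the others.
colour : ∀ {n} → Vec Bool (tri n) → Fin n → Fin n → Bool
colour {suc n} v zero    (suc j) = lookup (take n v) j
colour {suc n} v (suc i) (suc j) = colour (drop n v) i j
colour {suc n} v _       zero    = false

row : ∀ {n} → Bool → Subset n → Vec (Maybe Bool) n
row b = Vec.map (λ s → if s then just b else nothing)

monochromatic : ∀ {n} → Bool → Subset n → Vec (Maybe Bool) (tri n)
monochromatic b []                    = []
monochromatic b (_∷_ {n} outside S) = Vec.replicate n nothing ++ monochromatic b S
monochromatic b (inside ∷ S)          = row b S ++ monochromatic b S

Coloured : ∀ {n} → Bool → Vec Bool (tri n) → Subset n → Set
Coloured b v S = AllPairs (λ x y → colour v x y ≡ b) (elements S)

row-Matches : ∀ {n b} (v : Vec Bool n) S → All (λ j → lookup v j ≡ b) (elements S) → Matches (row b S) v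
row-Matches []      []            _          = []
row-Matches (_ ∷ v) (outside ∷ S) a          = free ∷ row-Matches v S (All.map⁻ a)
row-Matches (_ ∷ v) (inside  ∷ S) (refl ∷ a) = forced ∷ row-Matches v S (All.map⁻ a)

free-Matches : ∀ {n} (v : Vec Bool n) → Matches (Vec.replicate n nothing) v
free-Matches []      = []
free-Matches (_ ∷ v) = free ∷ free-Matches v

++-Matches : ∀ {m n} {c : Vec (Maybe Bool) m} {c′ : Vec (Maybe Bool) n} v →
  Matches c (take m v) → Matches c′ (drop m v) → Matches (c ++ c′) v
++-Matches {m} v p q = subst (Matches _) (take++drop≡id m v) (Pointwise.++⁺ p q)

Coloured⇒Matches : ∀ {n b} v (S : Subset n) → Coloured b v S → Matches (monochromatic b S) v
Coloured⇒Matches         []  []            _       = []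
Coloured⇒Matches {suc n} v (outside ∷ S) p       =
  ++-Matches v (free-Matches (take n v)) (Coloured⇒Matches (drop n v) S (AllPairs.map⁻ p))
Coloured⇒Matches {suc n} v (inside  ∷ S) (a ∷ p) =
  ++-Matches v (row-Matches (take n v) S (All.map⁻ a)) (Coloured⇒Matches (drop n v) S (AllPairs.map⁻ p))

weight-++ : ∀ {m n} (c : Vec (Maybe Bool) m) (c′ : Vec (Maybe Bool) n) → weight (c ++ c′) ≡ weight c * weight c′
weight-++ []            c′ = sym (+-identityʳ (weight c′))
weight-++ (nothing ∷ c) c′ = trans (cong₂ _+_ (weight-++ c c′) (weight-++ c c′)) (sym (*-distribʳ-+ (weight c′) (weight c) (weight c)))
weight-++ (just _  ∷ c) c′ = weight-++ c c′

weight-row : ∀ {n} b (S : Subset n) → weight (row b S) * 2 ^ ∣ S ∣ ≡ 2 ^ n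
weight-row b []            = refl
weight-row b (outside ∷ S) = trans (double (weight (row b S)) _) (cong (2 *_) (weight-row b S))
  where
  double : ∀ w x → (w + w) * x ≡ 2 * (w * x)
  double = solve-∀
weight-row b (inside ∷ S) = trans (swap (weight (row b S)) _) (cong (2 *_) (weight-row b S))
  where
  swap : ∀ w x → w * (2 * x) ≡ 2 * (w * x)
  swap = solve-∀

weight-free : ∀ n → weight (Vec.replicate n nothing) ≡ 2 ^ n
weight-free zero    = refl
weight-free (suc n) = cong₂ _+_ (weight-free n) (trans (weight-free n) (sym (+-identityʳ (2 ^ n))))

-- The event prescribes one bit for each pair in `S`, and every prescribed bit halves the weight.
weight-monochromatic : ∀ {n} b (S : Subset n) → weight (monochromatic b S) * 2 ^ tri ∣ S ∣ ≡ 2 ^ tri n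
weight-monochromatic b []                  = refl
weight-monochromatic b (_∷_ {n} outside S) = begin
  weight (Vec.replicate n nothing ++ c) * x  ≡⟨ cong (_* x) (weight-++ (Vec.replicate n nothing) c) ⟩
  weight (Vec.replicate n nothing) * weight c * x ≡⟨ cong (λ w → w * weight c * x) (weight-free n) ⟩
  2 ^ n * weight c * x                       ≡⟨ *-assoc (2 ^ n) (weight c) x ⟩
  2 ^ n * (weight c * x)                     ≡⟨ cong (2 ^ n *_) (weight-monochromatic b S) ⟩
  2 ^ n * 2 ^ tri n                          ≡⟨ sym (^-distribˡ-+-* 2 n (tri n)) ⟩
  2 ^ (n + tri n)                            ∎
  where
  open ≡-Reasoning
  c = monochromatic b S
  x = 2 ^ tri ∣ S ∣
weight-monochromatic b (_∷_ {n} inside S) = begin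
  weight (row b S ++ c) * 2 ^ (∣ S ∣ + tri ∣ S ∣)             ≡⟨ cong₂ _*_ (weight-++ (row b S) c) (^-distribˡ-+-* 2 ∣ S ∣ (tri ∣ S ∣)) ⟩
  weight (row b S) * weight c * (2 ^ ∣ S ∣ * 2 ^ tri ∣ S ∣)   ≡⟨ interchange (weight (row b S)) (weight c) _ _ ⟩
  weight (row b S) * 2 ^ ∣ S ∣ * (weight c * 2 ^ tri ∣ S ∣)   ≡⟨ cong₂ _*_ (weight-row b S) (weight-monochromatic b S) ⟩
  2 ^ n * 2 ^ tri n                                           ≡⟨ sym (^-distribˡ-+-* 2 n (tri n)) ⟩
  2 ^ (n + tri n)                                             ∎
  where
  open ≡-Reasoning
  c = monochromatic b S
  interchange : ∀ a b c d → (a * b) * (c * d) ≡ (a * c) * (b * d)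
  interchange = solve-∀

-- Colourings without large monochromatic sets

subsets : ∀ n → ℕ → List (Subset n)
subsets zero    zero    = [] ∷ []
subsets zero    (suc t) = []
subsets (suc n) zero    = List.map (outside ∷_) (subsets n zero)
subsets (suc n) (suc t) = List.map (inside ∷_) (subsets n t) List.++ List.map (outside ∷_) (subsets n (suc t))

∈-subsets : ∀ {n} (S : Subset n) → S ∈ˡ subsets n ∣ S ∣
∈-subsets S = complete S refl
  where
  complete : ∀ {n t} (S : Subset n) → ∣ S ∣ ≡ t → S ∈ˡ subsets n t
  complete             []            refl = here refl
  complete {t = suc t} (inside  ∷ S) p    = ∈-++⁺ˡ (∈-map⁺ (inside ∷_) (complete S (suc-injective p)))
  complete {t = zero}  (outside ∷ S) p    = ∈-map⁺ (outside ∷_) (complete S p)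
  complete {t = suc t} (outside ∷ S) p    = ∈-++⁺ʳ _ (∈-map⁺ (outside ∷_) (complete S p))

subsets-size : ∀ n t → All (λ S → ∣ S ∣ ≡ t) (subsets n t)
subsets-size zero    zero    = refl ∷ []
subsets-size zero    (suc t) = []
subsets-size (suc n) zero    = All.map⁺ (subsets-size n zero)
subsets-size (suc n) (suc t) = All.++⁺ (All.map⁺ (All.map (cong suc) (subsets-size n t))) (All.map⁺ (subsets-size n (suc t)))

length-subsets : ∀ n t → length (subsets n t) ≤ n ^ t
length-subsets zero    zero    = s≤s z≤n
length-subsets zero    (suc t) = z≤n
length-subsets (suc n) zero    = ≤-trans (≤-reflexive (length-map _ (subsets n zero))) (length-subsets n zero)
length-subsets (suc n) (suc t) = begin
  length (subsets (suc n) (suc t))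
    ≡⟨ trans (length-++ (List.map (inside ∷_) (subsets n t))) (cong₂ _+_ (length-map _ (subsets n t)) (length-map _ (subsets n (suc t)))) ⟩
  length (subsets n t) + length (subsets n (suc t))  ≤⟨ +-mono-≤ (length-subsets n t) (length-subsets n (suc t)) ⟩
  n ^ t + n * n ^ t                                  ≤⟨ *-monoʳ-≤ (suc n) (^-monoˡ-≤ t (n≤1+n n)) ⟩
  suc n ^ suc t                                      ∎
  where open ≤-Reasoning

totalWeight-uniform : ∀ {N K M} {cs : List (Vec (Maybe Bool) N)} →
  All (λ c → weight c * K ≡ M) cs → totalWeight cs * K ≡ length cs * M
totalWeight-uniform []                          = refl
totalWeight-uniform {K = K} {cs = c ∷ cs} (p ∷ ps) =
  trans (*-distribʳ-+ K (weight c) (totalWeight cs)) (cong₂ _+_ p (totalWeight-uniform ps))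

-- The Erdős lower bound for Ramsey numbers: there are at most `2 ^ (1 + d * t)` events, two for
-- each set of size `t`, and each has probability 1 over `2 ^ tri t`.
ramsey-colouring : ∀ n d t → n ≤ 2 ^ d → 1 + d * t ℕ.< tri t →
  ∃ λ (v : Vec Bool (tri n)) → ∀ b (S : Subset n) → ∣ S ∣ ≡ t → ¬ Coloured b v S
ramsey-colouring n d t n≤ t-big = let v , a = avoid-all (tri n) (events true List.++ events false) total in
  v , λ { true  S refl p → All.lookup (All.++⁻ˡ (events true) a) (∈-map⁺ _ (∈-subsets S)) (Coloured⇒Matches v S p)
        ; false S refl p → All.lookup (All.++⁻ʳ (events true) a) (∈-map⁺ _ (∈-subsets S)) (Coloured⇒Matches v S p) }
  where
  events : Bool → List (Vec (Maybe Bool) (tri n))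
  events b = List.map (monochromatic b) (subsets n t)

  events-weight : ∀ b → All (λ c → weight c * 2 ^ tri t ≡ 2 ^ tri n) (events b)
  events-weight b = All.map⁺ (All.map (λ { {S} refl → weight-monochromatic b S }) (subsets-size n t))

  count : length (events true List.++ events false) ℕ.< 2 ^ tri t
  count = begin-strict
    length (events true List.++ events false)          ≡⟨ length-++ (events true) ⟩
    length (events true) + length (events false)       ≡⟨ cong₂ _+_ (length-map _ (subsets n t)) (length-map _ (subsets n t)) ⟩
    length (subsets n t) + length (subsets n t)        ≤⟨ +-mono-≤ len (≤-trans len (m≤m+n _ 0)) ⟩
    2 ^ (1 + d * t)                                    <⟨ ^-monoʳ-< 2 (s≤s (s≤s z≤n)) t-big ⟩
    2 ^ tri t                                          ∎
    where
    open ≤-Reasoning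
    len : length (subsets n t) ≤ 2 ^ (d * t)
    len = ≤-trans (length-subsets n t) (≤-trans (^-monoˡ-≤ t n≤) (≤-reflexive (^-*-assoc 2 d t)))

  total : totalWeight (events true List.++ events false) ℕ.< 2 ^ tri n
  total = *-cancelʳ-< _ _ (2 ^ tri n) (begin-strict
    totalWeight (events true List.++ events false) * 2 ^ tri t   ≡⟨ totalWeight-uniform (All.++⁺ (events-weight true) (events-weight false)) ⟩
    length (events true List.++ events false) * 2 ^ tri n        <⟨ *-monoˡ-< (2 ^ tri n) {{m^n≢0 2 (tri n)}} count ⟩
    2 ^ tri t * 2 ^ tri n                                        ≡⟨ *-comm (2 ^ tri t) (2 ^ tri n) ⟩
    2 ^ tri n * 2 ^ tri t                                        ∎)
    where open ≤-Reasoning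

-- In closed form the sides are 2d² + 4d + 1 and 2d² + 7d + 6.
tri-large : ∀ d → 1 + d * (4 + d * 2) ℕ.< tri (4 + d * 2)
tri-large zero    = s≤s (s≤s z≤n)
tri-large (suc d) = begin-strict
  1 + (2 + t + d * (2 + t))                ≡⟨ expand d (d * 2) ⟩
  (1 + d * t) + (6 + d * 2 + d * 2)        <⟨ +-mono-<-≤ (tri-large d) (+-mono-≤ (m≤n+m (6 + d * 2) 3) (m≤n+m (d * 2) 0)) ⟩
  tri t + (9 + d * 2 + d * 2)              ≡⟨ collect (tri t) (d * 2) ⟩
  1 + t + (t + tri t)                      ∎
  where
  open ≤-Reasoning
  t = 4 + d * 2
  expand : ∀ d e → 1 + (2 + (4 + e) + d * (2 + (4 + e))) ≡ (1 + d * (4 + e)) + (6 + e + d * 2)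
  expand = solve-∀
  collect : ∀ x e → x + (9 + e + e) ≡ 1 + (4 + e) + ((4 + e) + x)
  collect = solve-∀

-- Mirsky's theorem

module _ {A : Set} (G : A → A → Bool) where

  Red Blue : A → A → Set
  Red  x y = G x y ≡ true
  Blue x y = G x y ≡ false

  -- Red pairs count only from an earlier to a later entry of the list, so this condition makes red
  -- a strict partial order on the positions.
  TransitiveOn : List A → Set
  TransitiveOn L = ∀ {x y z} → (x ∷ y ∷ z ∷ []) ⊆ˡ L → Red x y → Red y z → Red x z

  maximal nonmaximal : List A → List A
  maximal []          = []
  maximal (x ∷ xs)    = if any (G x) xs then maximal xs else x ∷ maximal xs
  nonmaximal []       = []
  nonmaximal (x ∷ xs) = if any (G x) xs then x ∷ nonmaximal xs else nonmaximal xs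

  any-false : ∀ x xs → any (G x) xs ≡ false → All (Blue x) xs
  any-false x []       _ = []
  any-false x (y ∷ xs) p with G x y in eq
  ... | false = eq ∷ any-false x xs p

  any-true : ∀ x xs → any (G x) xs ≡ true → ∃ λ y → (y ∷ []) ⊆ˡ xs × Red x y
  any-true x (y ∷ xs) p with G x y in eq
  ... | true  = y , refl ∷ minimum xs , eq
  ... | false with z , z∈xs , r ← any-true x xs p = z , y ∷ʳ z∈xs , r

  maximal-⊆ : ∀ L → maximal L ⊆ˡ L
  maximal-⊆ []       = []
  maximal-⊆ (x ∷ xs) with any (G x) xs
  ... | true  = x ∷ʳ maximal-⊆ xs
  ... | false = refl ∷ maximal-⊆ xs

  nonmaximal-⊆ : ∀ L → nonmaximal L ⊆ˡ L
  nonmaximal-⊆ []       = []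
  nonmaximal-⊆ (x ∷ xs) with any (G x) xs
  ... | true  = refl ∷ nonmaximal-⊆ xs
  ... | false = x ∷ʳ nonmaximal-⊆ xs

  maximal-Blue : ∀ L → AllPairs Blue (maximal L)
  maximal-Blue []       = []
  maximal-Blue (x ∷ xs) with any (G x) xs in eq
  ... | true  = maximal-Blue xs
  ... | false = All-resp-⊆ (maximal-⊆ xs) (any-false x xs eq) ∷ maximal-Blue xs

  length-maximal : ∀ L → length (maximal L) + length (nonmaximal L) ≡ length L
  length-maximal []       = refl
  length-maximal (x ∷ xs) with any (G x) xs
  ... | true  = trans (+-suc _ _) (cong suc (length-maximal xs))
  ... | false = cong suc (length-maximal xs)

  -- The last entry of a chain of nonmaximal entries forms a red pair with some later entry of `L`.
  -- That entry is appended, and transitivity makes it red to the rest of the chain.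
  extend-chain : ∀ {L x ch} → TransitiveOn L → (x ∷ ch) ⊆ˡ nonmaximal L → AllPairs Red (x ∷ ch) →
    ∃ λ ch⁺ → (x ∷ ch⁺) ⊆ˡ L × AllPairs Red (x ∷ ch⁺) × length ch⁺ ≡ suc (length ch)
  extend-chain {z ∷ L} tr sub red with any (G z) L in eq
  extend-chain {z ∷ L} tr sub red | false with ch⁺ , sub⁺ , red⁺ , len ← extend-chain {L} (tr ∘ (z ∷ʳ_)) sub red =
    ch⁺ , z ∷ʳ sub⁺ , red⁺ , len
  extend-chain {z ∷ L} tr (_ ∷ʳ sub) red | true with ch⁺ , sub⁺ , red⁺ , len ← extend-chain {L} (tr ∘ (z ∷ʳ_)) sub red =
    ch⁺ , z ∷ʳ sub⁺ , red⁺ , len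
  extend-chain {z ∷ L} {ch = []} tr (refl ∷ sub) red | true with w , w∈L , r ← any-true z L eq =
    w ∷ [] , refl ∷ w∈L , (r ∷ []) ∷ [] ∷ [] , refl
  extend-chain {z ∷ L} {ch = y ∷ ch} tr (refl ∷ sub) ((zy ∷ _) ∷ red) | true
    with ch⁺ , sub⁺ , red⁺@(y-red ∷ _) , len ← extend-chain {L} (tr ∘ (z ∷ʳ_)) sub red =
    y ∷ ch⁺ , refl ∷ sub⁺ , (zy ∷ All.tabulate z-red) ∷ red⁺ , cong suc len
    where
    z-red : ∀ {u} → u ∈ˡ ch⁺ → Red z u
    z-red u∈ = tr (refl ∷ ⊆-trans (refl ∷ from∈ u∈) sub⁺) zy (All.lookup y-red u∈)

  -- The maximal entries form an antichain, and by `extend-chain` removing them shortens the longest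
  -- chain, so induction on `a` applies.
  mirsky : ∀ a t L → TransitiveOn L →
    (∀ xs → xs ⊆ˡ L → AllPairs Red xs → length xs ≤ a) →
    (∀ xs → xs ⊆ˡ L → AllPairs Blue xs → length xs ≤ t) → length L ≤ a * t
  mirsky a       t []      tr chains antichains = z≤n
  mirsky zero    t (x ∷ L) tr chains antichains with () ← chains (x ∷ []) (refl ∷ minimum L) ([] ∷ [])
  mirsky (suc a) t L@(_ ∷ _) tr chains antichains = begin
    length L                                    ≡⟨ sym (length-maximal L) ⟩
    length (maximal L) + length (nonmaximal L)
      ≤⟨ +-mono-≤ (antichains (maximal L) (maximal-⊆ L) (maximal-Blue L))
           (mirsky a t (nonmaximal L) (tr ∘ up) chains′ λ xs sub → antichains xs (up sub)) ⟩
    t + a * t                                   ∎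
    where
    open ≤-Reasoning
    up : ∀ {xs} → xs ⊆ˡ nonmaximal L → xs ⊆ˡ L
    up sub = ⊆-trans sub (nonmaximal-⊆ L)
    chains′ : ∀ xs → xs ⊆ˡ nonmaximal L → AllPairs Red xs → length xs ≤ a
    chains′ []       _   _   = z≤n
    chains′ (x ∷ ch) sub red with ch⁺ , sub⁺ , red⁺ , len ← extend-chain {L} tr sub red =
      ℕ.s≤s⁻¹ (subst (ℕ._< suc a) len (chains (x ∷ ch⁺) sub⁺ red⁺))

-- The hypergraph of red-red-blue triples

redRedBlue : ∀ {A : Set} → (A → A → Bool) → List A → Bool
redRedBlue G (x ∷ y ∷ z ∷ []) = G x y ∧ G y z ∧ not (G x z)
redRedBlue G _                = false

-- The predicate in the recursive call remembers the entries before the deleted one; this is `deg`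
-- read on lists.
degList : ∀ {A : Set} → (List A → Bool) → List A → ℕ
degList p []       = 0
degList p (x ∷ xs) = ⟦ p xs ⟧ + degList (p ∘ (x ∷_)) xs

degList-map : ∀ {A B : Set} (f : A → B) p xs → degList p (List.map f xs) ≡ degList (p ∘ List.map f) xs
degList-map f p []       = refl
degList-map f p (x ∷ xs) = cong (⟦ p (List.map f xs) ⟧ +_) (degList-map f (p ∘ (f x ∷_)) xs)

deg-elements : ∀ {n} (p : List (Fin n) → Bool) W → deg (p ∘ elements) W ≡ degList p (elements W)
deg-elements p []            = refl
deg-elements p (outside ∷ W) = trans (deg-elements (p ∘ List.map suc) W) (sym (degList-map suc p (elements W)))
deg-elements p (inside  ∷ W) = cong (⟦ p (List.map suc (elements W)) ⟧ +_)
  (trans (deg-elements (p ∘ (zero ∷_) ∘ List.map suc) W) (sym (degList-map suc (p ∘ (zero ∷_)) (elements W))))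

all-Bool? : ∀ {P : Bool → Set} → (∀ b → Dec (P b)) → Dec (∀ b → P b)
all-Bool? P? = map′ (λ { (p , q) true → p ; (p , q) false → q }) (λ f → f true , f false) (P? true ×-dec P? false)

-- The triples xyz and xzw require opposite colours of xz, and xyw and yzw opposite colours of yw,
-- so each of these two couples has at most one edge. The proof checks all 64 colourings of the six
-- pairs.
redRedBlue-degList : ∀ {A : Set} (G : A → A → Bool) xs → length xs ≡ 4 → degList (redRedBlue G) xs ≤ 2
redRedBlue-degList G (x ∷ y ∷ z ∷ w ∷ []) refl = check (G x y) (G x z) (G x w) (G y z) (G y w) (G z w)
  where
  edgeCount : (xy xz xw yz yw zw : Bool) → ℕ
  edgeCount xy xz xw yz yw zw =
    ⟦ yz ∧ zw ∧ not yw ⟧ + (⟦ xz ∧ zw ∧ not xw ⟧ + (⟦ xy ∧ yw ∧ not xw ⟧ + (⟦ xy ∧ yz ∧ not xz ⟧ + 0)))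
  check : ∀ xy xz xw yz yw zw → edgeCount xy xz xw yz yw zw ≤ 2
  check = from-yes (all-Bool? λ xy → all-Bool? λ xz → all-Bool? λ xw → all-Bool? λ yz → all-Bool? λ yw → all-Bool? λ zw →
    edgeCount xy xz xw yz yw zw ℕ.≤? 2)

redRedBlue-deg : ∀ {n} (G : Fin n → Fin n → Bool) W → ∣ W ∣ ≡ 4 → deg (redRedBlue G ∘ elements) W ≤ 2
redRedBlue-deg G W size = subst (_≤ 2) (sym (deg-elements (redRedBlue G) W))
  (redRedBlue-degList G (elements W) (trans (length-elements W) size))

-- Homogeneous sets of the red-red-blue hypergraph

⊆-map⁻ : ∀ {A B : Set} (f : A → B) {xs} ys → xs ⊆ˡ List.map f ys → ∃ λ zs → zs ⊆ˡ ys × xs ≡ List.map f zs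
⊆-map⁻ f []       []           = [] , [] , refl
⊆-map⁻ f (y ∷ ys) (_ ∷ʳ sub)   with zs , sub′ , eq ← ⊆-map⁻ f ys sub = zs , y ∷ʳ sub′ , eq
⊆-map⁻ f (y ∷ ys) (refl ∷ sub) with zs , sub′ , eq ← ⊆-map⁻ f ys sub = y ∷ zs , refl ∷ sub′ , cong (f y ∷_) eq

⊆-elements : ∀ {n xs} (S : Subset n) → xs ⊆ˡ elements S → ∃ λ e → e ⊆ S × elements e ≡ xs
⊆-elements [] [] = [] , id , refl
⊆-elements (outside ∷ S) sub with zs , sub′ , refl ← ⊆-map⁻ suc (elements S) sub
  with e , e⊆S , eq ← ⊆-elements S sub′ = outside ∷ e , out⊆ e⊆S , cong (List.map suc) eq
⊆-elements (inside ∷ S) (_ ∷ʳ sub) with zs , sub′ , refl ← ⊆-map⁻ suc (elements S) sub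
  with e , e⊆S , eq ← ⊆-elements S sub′ = outside ∷ e , out⊆ e⊆S , cong (List.map suc) eq
⊆-elements (inside ∷ S) (refl ∷ sub) with zs , sub′ , refl ← ⊆-map⁻ suc (elements S) sub
  with e , e⊆S , eq ← ⊆-elements S sub′ = inside ∷ e , in⊆in e⊆S , cong ((zero ∷_) ∘ List.map suc) eq

Coloured-length : ∀ {n s b} {v : Vec Bool (tri n)} → (∀ (e : Subset n) → ∣ e ∣ ≡ suc s → ¬ Coloured b v e) →
  ∀ (S : Subset n) xs → xs ⊆ˡ elements S → AllPairs (λ x y → colour v x y ≡ b) xs → length xs ≤ s
Coloured-length {s = s} {b} {v} none S xs sub col = ≮⇒≥ λ s<xs →
  let e , e⊆S , eq = ⊆-elements S (⊆-trans (take-⊆ (suc s) xs) sub)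
      size = trans (sym (length-elements e)) (trans (cong length eq) (trans (length-take (suc s) xs) (m≤n⇒m⊓n≡m s<xs)))
  in none e size (subst (AllPairs _) (sym eq) (AllPairs.take⁺ (suc s) col))

-- Without red-red-blue triples red is transitive on `S`; chains and antichains are then the red and
-- blue monochromatic sets, of size at most `s`.
no-redRedBlue : ∀ {n s} {v : Vec Bool (tri n)} → (∀ b (e : Subset n) → ∣ e ∣ ≡ suc s → ¬ Coloured b v e) →
  ∀ (S : Subset n) → (∀ e → e ⊆ S → ∣ e ∣ ≡ 3 → redRedBlue (colour v) (elements e) ≡ false) → ∣ S ∣ ≤ s * s
no-redRedBlue {s = s} {v} none S blue = subst (_≤ s * s) (length-elements S)
  (mirsky (colour v) s s (elements S) tr (Coloured-length {v = v} (none true) S) (Coloured-length {v = v} (none false) S))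
  where
  tr : TransitiveOn (colour v) (elements S)
  tr {x} {y} {z} sub p q with e , e⊆S , eq ← ⊆-elements S sub
    with r ← trans (cong (redRedBlue (colour v)) (sym eq)) (blue e e⊆S (trans (sym (length-elements e)) (cong length eq)))
    rewrite p | q with colour v x z
  ... | true = refl

-- Four vertices of such a set would span four edges, but they span at most two.
all-redRedBlue : ∀ {n} (G : Fin n → Fin n → Bool) S →
  (∀ e → e ⊆ S → ∣ e ∣ ≡ 3 → redRedBlue G (elements e) ≡ true) → ∣ S ∣ ≤ 3
all-redRedBlue G S all = ≮⇒≥ λ 4≤S →
  let W , W⊆S , size = pick-size 4 S 4≤S
      deg≡4 = trans (cnt-on (λ x → redRedBlue G (elements (W ∖ x))) W true λ {x} x∈W →
                all (W ∖ x) (W⊆S ∘ ∖-⊆ W) (suc-injective (trans (∖-size x∈W) size))) (trans (*-identityʳ ∣ W ∣) size)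
  in <⇒≱ (s≤s (s≤s (s≤s z≤n))) (subst (_≤ 2) deg≡4 (redRedBlue-deg G W size))

polylog-by-colourings : ∀ {m} (F : Hypergraph 3 m) W → ∣ W ∣ ≡ 4 → deg (edge F) W ≢ 2 → PolylogHomogeneous F
polylog-by-colourings F W size deg≢2 = 4 , construct
  where
  f = deg (edge F) W
  -- Four vertices span at most two edges, and at least two in the complement. As `f` is not 2, the
  -- complement avoids `f` when `f` is smaller, the hypergraph itself when `f` is larger.
  flip-edges : Bool
  flip-edges = f ≤ᵇ 2

  P : ∀ {n} → Vec Bool (tri n) → Subset n → Bool
  P v e = flip-edges xor redRedBlue (colour v) (elements e)

  avoid : ∀ {n} (v : Vec Bool (tri n)) (V : Subset n) → ∣ V ∣ ≡ 4 → deg (P v) V ≢ f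
  avoid v V size eq with f ≤ᵇ 2 in t
  ... | false = subst T t (≤⇒≤ᵇ (subst (_≤ 2) eq (redRedBlue-deg (colour v) V size)))
  ... | true  = deg≢2 (≤-antisym (≤ᵇ⇒≤ f 2 (Equivalence.from T-≡ t)) (+-cancelˡ-≤ 2 2 f (begin
    4                                              ≡⟨ sym size ⟩
    ∣ V ∣                                          ≡⟨ sym (cnt-not _ V) ⟩
    deg (redRedBlue (colour v) ∘ elements) V + deg (not ∘ redRedBlue (colour v) ∘ elements) V
                                                   ≤⟨ +-monoˡ-≤ _ (redRedBlue-deg (colour v) V size) ⟩
    2 + deg (not ∘ redRedBlue (colour v) ∘ elements) V ≡⟨ cong (2 +_) eq ⟩
    2 + f                                          ∎)))
    where open ≤-Reasoning

  construct : ∀ ℓ n → 4 ≤ ℓ → n ≤ 2 ^ suc ℓ →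
    ∃ λ (H : Hypergraph 3 n) → InducedFree F H × (∀ S → Homogeneous H S → ∣ S ∣ ≤ ℓ ^ 4)
  construct ℓ n 4≤ℓ n≤ with v , none ← ramsey-colouring n (suc ℓ) (4 + suc ℓ * 2) n≤ (tri-large (suc ℓ)) =
    hypergraph 3 (P v) ,
    induced-free (hypergraph 3 (P v)) F W (λ V size′ eq → avoid v V (trans size′ size)
      (trans (sym (deg-hypergraph (P v) {V} (trans size′ size))) eq)) ,
    λ S hom → let b , const = homogeneous-constant (P v) hom in
      bound S (flip-edges xor b) λ e e⊆S size → unxor flip-edges (const e e⊆S size)
    where
    open ≤-Reasoning

    unxor : ∀ x {y b} → x xor y ≡ b → y ≡ x xor b
    unxor false         p    = p
    unxor true  {true}  refl = refl
    unxor true  {false} refl = refl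

    5+2ℓ≤ℓ² : 3 + suc ℓ * 2 ≤ ℓ ^ 2
    5+2ℓ≤ℓ² = begin
      5 + ℓ * 2          ≤⟨ +-monoˡ-≤ (ℓ * 2) (≤-trans (s≤s (s≤s (s≤s (s≤s (s≤s z≤n))))) (*-monoˡ-≤ 2 4≤ℓ)) ⟩
      ℓ * 2 + ℓ * 2      ≡⟨ sym (*-distribˡ-+ ℓ 2 2) ⟩
      ℓ * 4              ≤⟨ *-monoʳ-≤ ℓ 4≤ℓ ⟩
      ℓ * ℓ              ≡⟨ cong (ℓ *_) (sym (*-identityʳ ℓ)) ⟩
      ℓ ^ 2              ∎

    bound : ∀ S b → (∀ e → e ⊆ S → ∣ e ∣ ≡ 3 → redRedBlue (colour v) (elements e) ≡ b) → ∣ S ∣ ≤ ℓ ^ 4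
    -- The exponent 4 arises here: monochromatic sets have at most 5 + 2ℓ elements, hence at most
    -- `ℓ ^ 2`, and Mirsky's theorem squares this.
    bound S false const = begin
      ∣ S ∣                                ≤⟨ no-redRedBlue {v = v} none S const ⟩
      (3 + suc ℓ * 2) * (3 + suc ℓ * 2)    ≤⟨ *-mono-≤ 5+2ℓ≤ℓ² 5+2ℓ≤ℓ² ⟩
      ℓ ^ 2 * ℓ ^ 2                        ≡⟨ sym (^-distribˡ-+-* ℓ 2 2) ⟩
      ℓ ^ 4                                ∎
    bound S true const = begin
      ∣ S ∣                                ≤⟨ all-redRedBlue (colour v) S const ⟩
      3                                    ≤⟨ ≤-trans (n≤1+n 3) 4≤ℓ ⟩
      ℓ                                    ≡⟨ sym (^-identityʳ ℓ) ⟩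
      ℓ ^ 1                                ≤⟨ ^-monoʳ-≤ ℓ {{ℕ.>-nonZero (≤-trans (s≤s z≤n) 4≤ℓ)}} {1} {4} (s≤s z≤n) ⟩
      ℓ ^ 4                                ∎

-- 3-uniform hypergraphs in which any four vertices span exactly two edges

leftOne : ℕ → ℕ → Bool
leftOne a b = a ≡ᵇ 1

-- Sets of type `(2 , 2)` do span two edges, so the degree of a single four-set is no obstruction
-- and the whole copy `U` is used. With five vertices one side of its branching has three, and a set
-- of type `(1 , 3)` has degree at least 3, one of type `(3 , 1)` at most 1.
polylog-two-edges : ∀ {m} (F : Hypergraph 3 m) → 5 ≤ m → (∀ W → ∣ W ∣ ≡ 4 → deg (edge F) W ≡ 2) → PolylogHomogeneous F
polylog-two-edges F 5≤m two = polylog-by-splits F leftOne (λ ()) leftOne-free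
  where
  leftOne-free : ∀ {n d} (Bs : Vec (Subset n) d) → (∀ S → Separates Bs S) → InducedFree F (splitHypergraph 3 leftOne Bs)
  leftOne-free {n} Bs sep U iso = let a , b , s , ab = splits Bs U (sep U) (≤-trans (s≤s (s≤s z≤n)) 5≤U) in
    by-cases s (subst (5 ≤_) (sym ab) 5≤U)
    where
    H = splitHypergraph 3 leftOne Bs
    P = uncurry leftOne ∘ split Bs

    5≤U : 5 ≤ ∣ U ∣
    5≤U = subst (5 ≤_) (sym (↔⇒≡ (_≅_.bijection iso))) 5≤m

    deg≡2 : ∀ W → W ⊆ U → ∣ W ∣ ≡ 4 → deg P W ≡ 2
    deg≡2 W W⊆U size with V , refl ← ⊆-embed W⊆U = begin
      deg P (embed U V)                              ≡⟨ sym (deg-hypergraph P size) ⟩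
      deg (edge H) (embed U V)                       ≡⟨ deg-≅ {H = H} {F} {U} iso V ⟩
      deg (edge F) (image (_≅_.bijection iso) V)     ≡⟨ two _ (trans (∣image∣ (_≅_.bijection iso) V) (trans (sym (∣embed∣ U V)) size)) ⟩
      2                                              ∎
      where open ≡-Reasoning

    one-three : ∀ {v} → SplitDegree leftOne 1 3 v → v ≢ 2
    one-three s refl = let open SplitDegree s in
      <⇒≱ (n<1+n 2) (≤-trans (≤-reflexive (sym (β≡ refl))) (≤-trans (m≤n+m β α) (≤-reflexive (sym sum≡))))

    three-one : ∀ {v} → SplitDegree leftOne 3 1 v → v ≢ 2
    three-one s refl = let open SplitDegree s in
      <⇒≱ (n<1+n 1) (≤-trans (≤-reflexive (trans sum≡ (cong (_+ β) (α≡ refl)))) β≤)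

    by-cases : ∀ {a b} → Splits Bs U (suc a) (suc b) → ¬ (5 ≤ suc a + suc b)
    by-cases {a} {suc (suc b)} s _ =
      let W , W⊆U , size , s′ = pick-split {i = 0} {2} s (s≤s z≤n) (s≤s (s≤s (s≤s z≤n)))
      in one-three (deg-split leftOne s′) (deg≡2 W W⊆U size)
    by-cases {suc (suc a)} {b} s _ =
      let W , W⊆U , size , s′ = pick-split {i = 2} {0} s (s≤s (s≤s (s≤s z≤n))) (s≤s z≤n)
      in three-one (deg-split leftOne s′) (deg≡2 W W⊆U size)
    by-cases {0} {0} _ (s≤s (s≤s ()))
    by-cases {0} {1} _ (s≤s (s≤s (s≤s ())))
    by-cases {1} {0} _ (s≤s (s≤s (s≤s ())))
    by-cases {1} {1} _ (s≤s (s≤s (s≤s (s≤s ()))))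

-- Recognising `D₂`

co-singleton : ∀ {k} (e : Subset (suc k)) → ∣ e ∣ ≡ k → ∃ λ i → e ≡ ⊤ ∖ i
co-singleton         (outside ∷ e) p = zero , cong (outside ∷_) (∣p∣≡n⇒p≡⊤ p)
co-singleton {suc k} (inside  ∷ e) p with i , eq ← co-singleton e (suc-injective p) = suc i , cong (inside ∷_) eq

≢-size⇒no-edge : ∀ {k n} (H : Hypergraph k n) e → ∣ e ∣ ≢ k → edge H e ≡ false
≢-size⇒no-edge H e p = ¬-not λ t → p (uniform H e (Equivalence.from T-≡ t))

-- On `suc k` vertices the sets of size `k` are the complements of single vertices, and sets of
-- other sizes are edges of neither hypergraph.
≅-by-co-singletons : ∀ {k} {F G : Hypergraph k (suc k)} (π : Fin (suc k) ↔ Fin (suc k)) →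
  (∀ i → edge F (⊤ ∖ i) ≡ edge G (image π (⊤ ∖ i))) → F ≅ G
≅-by-co-singletons {k} {F} {G} π agree = record { bijection = π ; edges = edges′ }
  where
  edges′ : ∀ e → edge F e ≡ edge G (image π e)
  edges′ e with ∣ e ∣ ≟ k
  ... | yes p with i , refl ← co-singleton e p = agree i
  ... | no p  = trans (≢-size⇒no-edge F e p) (sym (≢-size⇒no-edge G (image π e) (p ∘ trans (sym (∣image∣ π e)))))

two-edges⇒≅D₂ : ∀ (F : Hypergraph 3 4) → deg (edge F) ⊤ ≡ 2 → F ≅ D₂
two-edges⇒≅D₂ F two = by-values _ _ _ _ refl refl refl refl two
  where
  by-values : ∀ b₀ b₁ b₂ b₃ → edge F (⊤ ∖ 0F) ≡ b₀ → edge F (⊤ ∖ 1F) ≡ b₁ → edge F (⊤ ∖ 2F) ≡ b₂ → edge F (⊤ ∖ 3F) ≡ b₃ →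
    ⟦ b₀ ⟧ + (⟦ b₁ ⟧ + (⟦ b₂ ⟧ + (⟦ b₃ ⟧ + 0))) ≡ 2 → F ≅ D₂
  -- The edges of `D₂` omit the vertices 3 and 2, so the bijection has to carry the two vertices
  -- omitted by the edges of `F` to these.
  by-values false false true  true  e₀ e₁ e₂ e₃ _ = ≅-by-co-singletons idₚ
    λ { 0F → e₀ ; 1F → e₁ ; 2F → e₂ ; 3F → e₃ }
  by-values false true  false true  e₀ e₁ e₂ e₃ _ = ≅-by-co-singletons (transpose 1F 2F)
    λ { 0F → e₀ ; 1F → e₁ ; 2F → e₂ ; 3F → e₃ }
  by-values true  false false true  e₀ e₁ e₂ e₃ _ = ≅-by-co-singletons (transpose 0F 2F)
    λ { 0F → e₀ ; 1F → e₁ ; 2F → e₂ ; 3F → e₃ }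
  by-values false true  true  false e₀ e₁ e₂ e₃ _ = ≅-by-co-singletons (transpose 1F 3F)
    λ { 0F → e₀ ; 1F → e₁ ; 2F → e₂ ; 3F → e₃ }
  by-values true  false true  false e₀ e₁ e₂ e₃ _ = ≅-by-co-singletons (transpose 0F 3F)
    λ { 0F → e₀ ; 1F → e₁ ; 2F → e₂ ; 3F → e₃ }
  by-values true  true  false false e₀ e₁ e₂ e₃ _ = ≅-by-co-singletons (transpose 0F 2F ∘ₚ transpose 1F 3F)
    λ { 0F → e₀ ; 1F → e₁ ; 2F → e₂ ; 3F → e₃ }
  by-values false false false false _ _ _ _ ()
  by-values false false false true  _ _ _ _ ()
  by-values false false true  false _ _ _ _ ()
  by-values false true  false false _ _ _ _ ()
  by-values true  false false false _ _ _ _ ()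
  by-values true  true  true  b     _ _ _ _ ()
  by-values true  true  false true  _ _ _ _ ()
  by-values true  false true  true  _ _ _ _ ()
  by-values false true  true  true  _ _ _ _ ()

-- Case distinction and logarithms

polylog : ∀ k {m} → (F : Hypergraph (3 + k) m) → 4 + k ≤ m → ¬ (F ≅ D₂) → PolylogHomogeneous F
polylog (suc k) F m≥ _ = uniformity≥4 F m≥
polylog zero {m} F m≥ F≇D₂ with anySubset? (λ W → (∣ W ∣ ≟ 4) ×-dec ¬? (deg (edge F) W ≟ 2))
... | yes (W , size , deg≢2) = polylog-by-colourings F W size deg≢2
... | no none with m≤n⇒m<n∨m≡n m≥
...   | inj₁ 5≤m  = polylog-two-edges F 5≤m λ W size → decidable-stable (_ ≟ 2) λ p → none (W , size , p)
...   | inj₂ refl = ⊥-elim (F≇D₂ (two-edges⇒≅D₂ F (decidable-stable (_ ≟ 2) λ p → none (⊤ , refl , p))))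

log-floor : ∀ n → 1 ≤ n → ∃ λ ℓ → 2 ^ ℓ ≤ n × n ℕ.< 2 ^ suc ℓ
log-floor (suc zero)      _ = 0 , s≤s z≤n , s≤s (s≤s z≤n)
log-floor (suc n@(suc _)) _ with ℓ , lo , hi ← log-floor n (s≤s z≤n) with m≤n⇒m<n∨m≡n hi
... | inj₁ n<  = ℓ , m≤n⇒m≤1+n lo , n<
... | inj₂ eq  = suc ℓ , ≤-reflexive (sym eq) , subst (ℕ._< 2 ^ suc (suc ℓ)) (sym eq) (^-monoʳ-< 2 (s≤s (s≤s z≤n)) (n<1+n (suc ℓ)))

^-distribʳ-* : ∀ x y n → (x * y) ^ n ≡ x ^ n * y ^ n
^-distribʳ-* x y zero    = refl
^-distribʳ-* x y (suc n) = trans (cong (x * y *_) (^-distribʳ-* x y n)) ([m*n]*[o*p]≡[m*o]*[n*p] x y (x ^ n) (y ^ n))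

-- From `2 ^ (ℓ * b) ≤ n ^ b ≤ 2 ^ a` follows `ℓ * b ≤ a`, and fourth powers give the claim.
^4⇒≤log₂ : ∀ {s n} ℓ → 2 ^ ℓ ≤ n → s ≤ ℓ ^ 4 → s ≤log₂ n ^ (ℤ.+ 4 / 1)
^4⇒≤log₂ {s} {n} ℓ lo s≤ a b _ n^b≤ = begin
  s ^ 1 * b ^ 4      ≡⟨ cong (_* b ^ 4) (^-identityʳ s) ⟩
  s * b ^ 4          ≤⟨ *-monoˡ-≤ (b ^ 4) s≤ ⟩
  ℓ ^ 4 * b ^ 4      ≡⟨ sym (^-distribʳ-* ℓ b 4) ⟩
  (ℓ * b) ^ 4        ≤⟨ ^-monoˡ-≤ 4 ℓb≤a ⟩
  a ^ 4              ∎
  where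
  open ≤-Reasoning
  ℓb≤a : ℓ * b ≤ a
  ℓb≤a = ≮⇒≥ λ a<ℓb → <⇒≱ (^-monoʳ-< 2 (s≤s (s≤s z≤n)) a<ℓb)
    (≤-trans (≤-reflexive (sym (^-*-assoc 2 ℓ b))) (≤-trans (^-monoˡ-≤ b lo) n^b≤))

claim1p3 : ∀ (k m : ℕ) → k ≥ 3 → (F : Hypergraph k m) → m ≥ k + 1 → ¬ (F ≅ D₂) →
    ∃[ C ] (0ℚ < C × ∃[ N ] (∀ (n : ℕ) → n ≥ N →
    ∃[ H ] (InducedFree {k} {m} {n} F H × (∀ S → Homogeneous H S → ∣ S ∣ ≤log₂ n ^ C))))
claim1p3 (suc (suc (suc k))) m (s≤s (s≤s (s≤s _))) F m≥ F≇D₂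
  with L , construct ← polylog k F (subst (_≤ m) (+-comm (3 + k) 1) m≥) F≇D₂ =
  -- The threshold `2 ^ L` ensures that the integral part `ℓ` of log₂ n is at least `L`.
  ℤ.+ 4 / 1 , *<* (+<+ (s≤s z≤n)) , 2 ^ L , λ n n≥ →
  let ℓ , lo , hi = log-floor n (≤-trans (m^n>0 2 L) n≥)
      L≤ℓ = ≮⇒≥ λ ℓ<L → <⇒≱ hi (≤-trans (^-monoʳ-≤ 2 ℓ<L) n≥)
      H , F-free , bound = construct ℓ n L≤ℓ (<⇒≤ hi)
  in H , F-free , λ S hom → ^4⇒≤log₂ ℓ lo (bound S hom)
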